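{- Let $P$ be a circuit partition of the 4-regular multigraph $F$, and let $C$ be an Euler system of $F$. (i) The nullspace of the relative interlacement matrix $\mathcal{I}_{P}(C)$ is spanned by the relative core vectors $\rho(\gamma,C)$ of the circuits $\gamma\in P$. (ii) For each connected component of $F$, the relative core vectors $\rho(\gamma,C)$ of the circuits $\gamma$ of $P$ incident on that component sum to $0$. (iii) If $Q\subset P$ and there is no connected component of $F$ for which $Q$ contains every incident circuit of $P$, then the relative core vectors $\rho(\gamma,C)$ of the circuits $\gamma\in Q$ are linearly independent.
   Context: Multigraphs are finite; in a 4-regular multigraph every vertex has degree 4, and loops and parallel edges are allowed (a loop contributes 2 to the degree of its vertex). Each edge consists of two half-edges, so exactly four half-edges are incident at each vertex. A transition at a vertex $v$ is one of the three ways to sort the four half-edges at $v$ into two disjoint pairs. A circuit is a closed walk with no repeated edge; circuits are considered without preferred starting point or orientation. Choosing one transition at each vertex of $F$ yields a partition of the edge set $E(F)$ into edge-disjoint circuits (consecutive half-edges of a circuit passing through a vertex are those paired by the chosen transition); such a partition, together with its transitions, is a circuit partition $P$ of $F$, and $P$ is said to involve the chosen transition at each vertex. An Euler system is a circuit partition containing exactly one circuit (an Euler circuit, containing every edge of the component) for each connected component of $F$. Interlacement: given an Euler system $C$, two vertices $v\neq w$ are interlaced with respect to $C$ if they appear in the order $v\ldots w\ldots v\ldots w$ on one of the circuits of $C$. The interlacement matrix $\mathcal{I}(C)$ is the $V(F)\times V(F)$ zero-diagonal symmetric matrix over $GF(2)$ whose $vw$ entry ($v\neq w$) is $1$ if and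 only if $v$ and $w$ are interlaced with respect to $C$. Transition labels with respect to $C$: at a vertex $v$, orient the circuit of $C$ incident at $v$ (either way). The transition followed by $C$ at $v$ is labeled $\phi$; the other transition in which in-directed half-edges are paired with out-directed half-edges is labeled $\chi$; the transition in which the two in-directed half-edges are paired with each other and the two out-directed half-edges are paired with each other is labeled $\psi$. Relative interlacement matrix: for a circuit partition $P$ and Euler system $C$ of $F$, $\mathcal{I}_P(C)$ is obtained from $\mathcal{I}(C)$ as follows. If $P$ involves the $\phi$ transition at $v$, change every nonzero entry of the row and column corresponding to $v$ to $0$, and change the diagonal entry of $v$ from $0$ to $1$. If $P$ involves the $\psi$ transition at $v$, change the diagonal entry of $v$ from $0$ to $1$. (No change on account of vertices where $P$ involves the $\chi$ transition.) Relative core vector: for $\gamma\in P$, $\rho(\gamma,C)\in GF(2)^{V(F)}$ is the vector whose nonzero entries correspond to the vertices $v$ at which $P$ involves either the $\chi$ or the $\psi$ transition (with respect to $C$) and $\gamma$ is singly incident, i.e. $\gamma$ includes precisely two of the four half-edges at $v$. In (iii), linear independence refers to the family $(\rho(\gamma,C))_{\gamma\in Q}$ indexed by $Q$. -}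

module Defs where

open import Algebra.Bundles using (CommutativeRing)
import Algebra.Properties.CommutativeMonoid.Sum as Sum
open import Data.Bool.Base using (Bool; false; true; not; if_then_else_)
open import Data.Bool.Properties using (xor-∧-commutativeRing)
import Data.Bool.Properties as Bool
open import Data.Fin.Base using (Fin; toℕ; _<_)
open import Data.Fin.Properties using (_≟_; _<?_; any?)
open import Data.Fin.Subset using (Subset; _∈_; _∉_)
open import Data.Fin.Subset.Properties using (_∈?_)
open import Data.List.Base using (List; []; _∷_; length; filter; allFin; cartesianProduct)
open import Data.List.Relation.Unary.All using (All; all?)
open import Data.Nat.Base using (ℕ; suc)
import Data.Nat.Properties as ℕ
open import Data.Nat.DivMod using (_mod_)
open import Data.Product using (_×_; _,_; proj₁; ∃!; ∃-syntax)
open import Data.Product.Properties using (≡-dec)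
open import Data.Sum.Base using (_⊎_)
open import Data.Vec.Functional using (Vector)
open import Function.Base using (_∘_)
open import Function.Bundles using (_⇔_)
open import Function.Definitions using (Injective)
open import Relation.Binary.Construct.Closure.ReflexiveTransitive using (Star)
open import Relation.Binary.Definitions using (DecidableEquality)
open import Relation.Binary.PropositionalEquality using (_≡_; _≢_; _≗_)
open import Relation.Nullary.Decidable using (Dec; does; ¬?; _×-dec_; _⊎-dec_)
open import Relation.Nullary.Negation using (¬_)

------------------------------------------------------------------------
-- Linear algebra over GF(2)

-- GF(2) is Bool with exclusive or as addition and conjunction as
-- multiplication, so `does` turns a decidable property into the entry
-- that is 1 exactly when the property holds.
open CommutativeRing xor-∧-commutativeRing public
  using (0#; _*_)
  renaming (Carrier to GF2)
open Sum (CommutativeRing.+-commutativeMonoid xor-∧-commutativeRing) public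
  using (sum)

Matrix : ℕ → ℕ → Set
Matrix m n = Vector (Vector GF2 n) m

0ᵛ : ∀ {n} → Vector GF2 n
0ᵛ _ = 0#

_*ᵛ_ : ∀ {m n} → Matrix m n → Vector GF2 n → Vector GF2 m
(M *ᵛ x) i = sum (λ j → M i j * x j)

combination : ∀ {k n} → Vector GF2 k → Vector (Vector GF2 n) k → Vector GF2 n
combination c f i = sum (λ γ → c γ * f γ i)

Nullspace : ∀ {m n} → Matrix m n → Vector GF2 n → Set
Nullspace M x = M *ᵛ x ≗ 0ᵛ

Span : ∀ {k n} → Vector (Vector GF2 n) k → Vector GF2 n → Set
Span f x = ∃[ c ] x ≗ combination c f

-- Linear independence of the family (f γ) indexed by γ ∈ Q.
LinearlyIndependentOn : ∀ {k n} → Subset k → Vector (Vector GF2 n) k → Set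
LinearlyIndependentOn {k} Q f =
  (c : Vector GF2 k) → (∀ γ → γ ∉ Q → c γ ≡ 0#) →
  combination c f ≗ 0ᵛ → ∀ γ → γ ∈ Q → c γ ≡ 0#

------------------------------------------------------------------------
-- Multigraphs

-- The edge e has the two half-edges (e , false) and (e , true), attached
-- to the vertices end e false and end e true.
record Multigraph : Set where
  field
    #V #E : ℕ
    end   : Fin #E → Bool → Fin #V

  Vertex Edge HalfEdge : Set
  Vertex   = Fin #V
  Edge     = Fin #E
  HalfEdge = Edge × Bool

  edge : HalfEdge → Edge
  edge = proj₁

  vertex : HalfEdge → Vertex
  vertex (e , b) = end e b

  opposite : HalfEdge → HalfEdge
  opposite (e , b) = e , not b

  _≟ʰ_ : DecidableEquality HalfEdge
  _≟ʰ_ = ≡-dec _≟_ Bool._≟_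

  halfEdgesAt : Vertex → List HalfEdge
  halfEdgesAt v =
    filter (λ h → vertex h ≟ v) (cartesianProduct (allFin #E) (false ∷ true ∷ []))

  degree : Vertex → ℕ
  degree v = length (halfEdgesAt v)

  Adjacent : Vertex → Vertex → Set
  Adjacent v w = ∃[ h ] vertex h ≡ v × vertex (opposite h) ≡ w

  Connected : Vertex → Vertex → Set
  Connected = Star Adjacent

  IsComponent : Subset #V → Set
  IsComponent K = ∃[ v ] (∀ w → w ∈ K ⇔ Connected v w)

FourRegular : Multigraph → Set
FourRegular F = ∀ v → degree v ≡ 4
  where open Multigraph F

------------------------------------------------------------------------
-- Circuits and circuit partitions

cyclicSuc : ∀ {n} → Fin (suc n) → Fin (suc n)
cyclicSuc {n} i = suc (toℕ i) mod suc n

module _ (F : Multigraph) where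
  open Multigraph F

  -- A closed walk without repeated edges, written from some starting point
  -- in one of its two directions.  The walk leaves its i-th vertex through
  -- the half-edge out i and reaches the next one through opposite (out i).
  record Circuit : Set where
    field
      length-1 : ℕ

    Position : Set
    Position = Fin (suc length-1)

    field
      out    : Position → HalfEdge
      closed : ∀ i → vertex (opposite (out i)) ≡ vertex (out (cyclicSuc i))
      trail  : Injective _≡_ _≡_ (edge ∘ out)

    at : Position → Vertex
    at i = vertex (out i)

    ContainsEdge : Edge → Set
    ContainsEdge e = ∃[ i ] edge (out i) ≡ e

    containsEdge? : ∀ e → Dec (ContainsEdge e)
    containsEdge? e = any? λ i → edge (out i) ≟ e

    IncidentOn : Subset #V → Set
    IncidentOn K = ∃[ i ] at i ∈ K

    incidentOn? : ∀ K → Dec (IncidentOn K)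
    incidentOn? K = any? λ i → at i ∈? K

    SinglyIncident : Vertex → Set
    SinglyIncident v =
      length (filter (containsEdge? ∘ edge) (halfEdgesAt v)) ≡ 2

    singlyIncident? : ∀ v → Dec (SinglyIncident v)
    singlyIncident? v = _ ℕ.≟ 2

    -- As a circuit has no preferred starting point, the cyclic order
    -- v…w…v…w can also be read as w…v…w…v.
    Interlaces : Vertex → Vertex → Set
    Interlaces v w = ∃[ i ] ∃[ j ] ∃[ k ] ∃[ l ] (i < j × j < k × k < l) ×
      ((at i ≡ v × at j ≡ w × at k ≡ v × at l ≡ w) ⊎
       (at i ≡ w × at j ≡ v × at k ≡ w × at l ≡ v))

    interlaces? : ∀ v w → Dec (Interlaces v w)
    interlaces? v w = any? λ i → any? λ j → any? λ k → any? λ l →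
      (i <? j ×-dec j <? k ×-dec k <? l) ×-dec
      ((at i ≟ v ×-dec at j ≟ w ×-dec at k ≟ v ×-dec at l ≟ w) ⊎-dec
       (at i ≟ w ×-dec at j ≟ v ×-dec at k ≟ w ×-dec at l ≟ v))

  -- A choice of a transition at every vertex, as the map sending each
  -- half-edge to the one it is paired with.
  record TransitionChoice : Set where
    field
      partner            : HalfEdge → HalfEdge
      partner-vertex     : ∀ h → vertex (partner h) ≡ vertex h
      partner-involutive : ∀ h → partner (partner h) ≡ h
      partner-distinct   : ∀ h → partner h ≢ h

  record CircuitPartition : Set where
    field
      transitions : TransitionChoice
      size        : ℕ
      circuit     : Fin size → Circuit

    open TransitionChoice transitions public

    field
      follows   : ∀ γ → let open Circuit (circuit γ) in
                  ∀ i → partner (opposite (out i)) ≡ out (cyclicSuc i)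
      partition : ∀ e → ∃! _≡_ λ γ → Circuit.ContainsEdge (circuit γ) e

    Incident : Subset #V → Fin size → Set
    Incident K γ = Circuit.IncidentOn (circuit γ) K

    incident? : ∀ K γ → Dec (Incident K γ)
    incident? K γ = Circuit.incidentOn? (circuit γ) K

    incidenceVector : Subset #V → Vector GF2 size
    incidenceVector K γ = does (incident? K γ)

  IsEulerSystem : CircuitPartition → Set
  IsEulerSystem C =
    ∀ K → IsComponent K → ∃! _≡_ (CircuitPartition.Incident C K)

------------------------------------------------------------------------
-- Interlacement and transition labels with respect to C

  module _ (C : CircuitPartition) where
    open CircuitPartition C

    Interlaced : Vertex → Vertex → Set
    Interlaced v w = v ≢ w × ∃[ γ ] Circuit.Interlaces (circuit γ) v w

    interlaced? : ∀ v w → Dec (Interlaced v w)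
    interlaced? v w =
      ¬? (v ≟ w) ×-dec any? λ γ → Circuit.interlaces? (circuit γ) v w

    interlacement : Matrix #V #V
    interlacement v w = does (interlaced? v w)

    -- Each circuit of C is oriented in the direction in which it is
    -- written; reversing a circuit exchanges OutDirected and InDirected at
    -- its vertices, which leaves the labels φ, χ and ψ unchanged.
    OutDirected InDirected : HalfEdge → Set
    OutDirected h = ∃[ γ ] ∃[ i ] Circuit.out (circuit γ) i ≡ h
    InDirected  h = OutDirected (opposite h)

    outDirected? : ∀ h → Dec (OutDirected h)
    outDirected? h = any? λ γ → any? λ i → Circuit.out (circuit γ) i ≟ʰ h

    inDirected? : ∀ h → Dec (InDirected h)
    inDirected? h = outDirected? (opposite h)

  -- Involves-φ P C v: the transition of P at v is the one labelled φ with
  -- respect to C; similarly for χ and ψ.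
  module _ (P C : CircuitPartition) where
    private
      module P = CircuitPartition P
      module C = CircuitPartition C

    Involves-φ Involves-χ Involves-ψ : Vertex → Set
    Involves-φ v = All (λ h → P.partner h ≡ C.partner h) (halfEdgesAt v)
    Involves-χ v = ¬ Involves-φ v ×
      All (λ h → (InDirected C h × OutDirected C (P.partner h)) ⊎
                 (OutDirected C h × InDirected C (P.partner h))) (halfEdgesAt v)
    Involves-ψ v =
      All (λ h → (InDirected C h × InDirected C (P.partner h)) ⊎
                 (OutDirected C h × OutDirected C (P.partner h))) (halfEdgesAt v)

    involves-φ? : ∀ v → Dec (Involves-φ v)
    involves-φ? v = all? (λ h → P.partner h ≟ʰ C.partner h) (halfEdgesAt v)

    involves-χ? : ∀ v → Dec (Involves-χ v)
    involves-χ? v = ¬? (involves-φ? v) ×-dec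
      all? (λ h → (inDirected? C h ×-dec outDirected? C (P.partner h)) ⊎-dec
                  (outDirected? C h ×-dec inDirected? C (P.partner h))) (halfEdgesAt v)

    involves-ψ? : ∀ v → Dec (Involves-ψ v)
    involves-ψ? v =
      all? (λ h → (inDirected? C h ×-dec inDirected? C (P.partner h)) ⊎-dec
                  (outDirected? C h ×-dec outDirected? C (P.partner h))) (halfEdgesAt v)

    relativeInterlacement : Matrix #V #V
    relativeInterlacement v w =
      if does (v ≟ w)
      then does (involves-φ? v ⊎-dec involves-ψ? v)
      else if does (involves-φ? v ⊎-dec involves-φ? w)
      then 0#
      else interlacement C v w

    relativeCore : Fin P.size → Vector GF2 #V
    relativeCore γ v =
      does ((involves-χ? v ⊎-dec involves-ψ? v) ×-dec
            Circuit.singlyIncident? (P.circuit γ) v)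

{-# OPTIONS --safe #-}
module Submission where

-- The proof replaces vectors x indexed by vertices by GF(2)-labellings z of
-- the edges.  Say that z jumps by x when, for every vertex v, its value changes
-- by x v at each of the two passes of the Euler system C through v.
--
-- Every x is the jump vector of some z (potential-jumps): label the edges of
-- each circuit of C by the prefix sums of x along it.  This closes up around
-- the circuit because both passes through a vertex lie on the same circuit
-- (vertex-circuitOf), so that each vertex is met an even number of times.
--
-- Between the two departures of C from a vertex v, the label changes by the sum
-- of x over the vertices passed: v itself once, the vertices interlaced with v
-- once, and all others an even number of times.  So the difference of the two
-- labels is the sum of x v and the v entry of the product of the interlacement
-- matrix with x (visits-sum).  Comparing with the way in which a φ, χ or ψ
-- transition pairs the four half-edges at v gives relativeInterlacement-jumps:
-- when x vanishes at the φ vertices, the v entry of the product of the relative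
-- interlacement matrix with x is the difference of the labels of any two
-- half-edges at v that P pairs.  Hence x lies in the nullspace exactly when z is
-- constant on the circuits of P; the rows of the φ vertices express the
-- vanishing of x there.
--
-- A labelling that is constant on the circuits of P is a combination of their
-- characteristic functions, and the characteristic function of a circuit γ
-- of P jumps by the relative core vector of γ (onCircuit-jump).  This gives
-- combination-core, from which the three claims follow.  The nullspace is
-- spanned by the core vectors, as just explained.  The circuits incident on a
-- component K combine to the characteristic function of the edges of K, which
-- has no jumps.  And if a combination of core vectors vanishes, the corresponding
-- combination of characteristic functions is constant on the circuits of C, hence
-- on components, so that a nonzero coefficient forces the coefficients of all
-- circuits incident on some component to be nonzero.

open import Defs
open import Data.Fin.Subset using (Subset; _∈_)
open import Data.Product.Base using (_×_; ∃-syntax)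
open import Function.Bundles using (_⇔_)
open import Relation.Binary.PropositionalEquality using (_≗_)
open import Relation.Nullary.Negation using (¬_)

open import Algebra.Bundles using (CommutativeRing)
open import Data.Bool.Base using (Bool; true; false; not; _xor_; _∧_; _∨_; if_then_else_)
open import Data.Bool.Properties
  using (xor-∧-commutativeRing; ∧-zeroʳ; ∨-zeroʳ; not-distribʳ-xor;
         ∧-assoc; ∧-comm; ∧-distribˡ-xor; ∧-distribʳ-xor;
         xor-same; xor-assoc; xor-comm; xor-identityʳ; xor-annihilates-not; not-involutive; not-¬; ¬-not)
import Data.Bool.Properties as Bool
open import Data.Fin.Base using (Fin; zero; suc; toℕ; fromℕ; inject₁; _<_)
open import Data.Fin.Induction using (<-weakInduction)
open import Data.Fin.Properties
  using (_≟_; _≤?_; toℕ-injective; toℕ-fromℕ; toℕ-fromℕ<; toℕ-inject₁; toℕ<n; toℕ≤pred[n];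
         <-cmp; <-trans; <-asym; <-irrefl; sequence)
open import Data.Fin.Relation.Unary.Top using (view; ‵fromℕ; ‵inject₁)
open import Data.List.Base using (List; []; _∷_; _++_; length; filter; allFin; cartesianProduct)
open import Data.List.Properties using (length-++)
open import Data.List.Membership.Propositional using (find; lose) renaming (_∈_ to _∈ˡ_)
open import Data.List.Membership.Propositional.Properties
  using (∈-∃++; ∈-filter⁺; ∈-filter⁻; ∈-cartesianProduct⁺; ∈-allFin)
open import Data.List.Relation.Binary.Permutation.Propositional
  using (_↭_; ↭-refl; ↭-trans; prep)
open import Data.List.Relation.Binary.Permutation.Propositional.Properties
  using (shift; ↭-length; ∈-resp-↭; filter-↭; ++-identityʳ)
open import Data.List.Relation.Unary.All as All using (All; []; _∷_)
open import Data.List.Relation.Unary.Any using (here; there; any?)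
open import Data.List.Relation.Unary.AllPairs using ([]; _∷_)
open import Data.List.Relation.Unary.Unique.Propositional using (Unique)
open import Data.List.Relation.Unary.Unique.Propositional.Properties
  using (allFin⁺; cartesianProduct⁺; filter⁺)
open import Data.Nat.Base as ℕ using (ℕ)
open import Data.Nat.DivMod using (_%_; m<n⇒m%n≡m; n%n≡0)
import Data.Nat.Properties as ℕ
open import Data.Product.Base using (_,_; proj₁; proj₂)
open import Data.Sum.Base as Sum using (_⊎_; inj₁; inj₂)
open import Data.Vec.Base using (tabulate)
open import Data.Vec.Properties using (lookup∘tabulate; []=⇒lookup; lookup⇒[]=)
open import Data.Vec.Functional using (Vector)
open import Data.Fin.Subset.Properties using (_∈?_)
open import Function.Bundles using (mk⇔; Equivalence)
open import Relation.Binary.Construct.Closure.ReflexiveTransitive using (ε; _◅_; _◅◅_)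
open import Effect.Monad using (RawMonad)
open import Function.Base using (_∘_; case_of_)
open import Relation.Binary.Definitions using (tri<; tri≈; tri>)
open import Relation.Binary.PropositionalEquality
  using (_≡_; _≢_; refl; sym; trans; cong; cong₂; subst; module ≡-Reasoning)
open import Relation.Nullary.Decidable
  using (Dec; yes; no; does; dec-true; dec-false; does-⇔; decidable-stable; ¬?; _×-dec_; ¬¬-excluded-middle)
open import Relation.Nullary.Negation using (contradiction; ¬¬-map; ¬¬-Monad)

open import Algebra.Properties.Semiring.Sum
  (CommutativeRing.semiring xor-∧-commutativeRing)
  using (sum-cong-≗; ∑-distrib-+; ∑-comm; *-distribˡ-sum; *-distribʳ-sum;
         sum-replicate-zero)

open ≡-Reasoning

------------------------------------------------------------------------
-- Arithmetic over GF(2)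

xor-cancelʳ : ∀ a b → (a xor b) xor b ≡ a
xor-cancelʳ a b = trans (xor-assoc a b b) (trans (cong (a xor_) (xor-same b)) (xor-identityʳ a))

xor-cancelˡ : ∀ a b → a xor (a xor b) ≡ b
xor-cancelˡ a b = trans (sym (xor-assoc a a b)) (cong (_xor b) (xor-same a))

xor-false⇒≡ : ∀ {a b} → a xor b ≡ false → a ≡ b
xor-false⇒≡ {a} {b} eq = trans (sym (xor-cancelʳ a b)) (cong (_xor b) eq)

xor-cancel-common : ∀ a b c → (a xor c) xor (b xor c) ≡ a xor b
xor-cancel-common a b false = cong₂ _xor_ (xor-identityʳ a) (xor-identityʳ b)
xor-cancel-common a b true  = trans (cong₂ _xor_ (xor-comm a true) (xor-comm b true))
                                    (xor-annihilates-not a b)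

xor-transpose : ∀ {a b c d} → a xor c ≡ b xor d → a xor b ≡ d xor c
xor-transpose {a} {b} {c} {d} eq = begin
  a xor b                    ≡⟨ xor-cancel-common a b c ⟨
  (a xor c) xor (b xor c)    ≡⟨ cong₂ _xor_ (trans eq (xor-comm b d)) (xor-comm b c) ⟩
  (d xor b) xor (c xor b)    ≡⟨ xor-cancel-common d c b ⟩
  d xor c                    ∎

sum-0 : ∀ {n} {f : Vector GF2 n} → (∀ i → f i ≡ false) → sum f ≡ false
sum-0 {n} f≡0 = trans (sum-cong-≗ f≡0) (sum-replicate-zero n)

-- The vector of entries does (j ≟ i) is the Kronecker delta at i.
sum-δ : ∀ {n} (i : Fin n) (f : Vector GF2 n) →
        sum (λ j → does (j ≟ i) ∧ f j) ≡ f i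
sum-δ {ℕ.suc n} zero    f = trans (cong (f zero xor_) (sum-replicate-zero n)) (xor-identityʳ _)
sum-δ           (suc i) f = sum-δ i (f ∘ suc)

sum-δʳ : ∀ {n} (i : Fin n) (f : Vector GF2 n) →
         sum (λ j → f j ∧ does (j ≟ i)) ≡ f i
sum-δʳ i f = trans (sum-cong-≗ λ j → ∧-comm (f j) _) (sum-δ i f)

sum-xor-∧ : ∀ {n} {e d d′ : Vector GF2 n} (f : Vector GF2 n) → (∀ k → e k ≡ d k xor d′ k) →
            sum (λ k → e k ∧ f k) ≡ sum (λ k → d k ∧ f k) xor sum (λ k → d′ k ∧ f k)
sum-xor-∧ {d = d} {d′} f e≡ = trans
  (sum-cong-≗ λ k → trans (cong (_∧ f k) (e≡ k)) (∧-distribʳ-xor (f k) (d k) (d′ k)))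
  (∑-distrib-+ (λ k → d k ∧ f k) (λ k → d′ k ∧ f k))

-- A sum over a finite set may be grouped along the fibres of a map.
sum-fibres : ∀ {m n} (π : Fin m → Fin n) (g : Vector GF2 m) (f : Vector GF2 n) →
             sum (λ k → g k ∧ f (π k)) ≡ sum (λ w → sum (λ k → does (π k ≟ w) ∧ g k) ∧ f w)
sum-fibres π g f = begin
  sum (λ k → g k ∧ f (π k))
    ≡⟨ sum-cong-≗ (λ k → cong (g k ∧_) (sum-δ (π k) f)) ⟨
  sum (λ k → g k ∧ sum (λ w → does (w ≟ π k) ∧ f w))
    ≡⟨ sum-cong-≗ (λ k → *-distribˡ-sum (g k) (λ w → does (w ≟ π k) ∧ f w)) ⟩
  sum (λ k → sum (λ w → g k ∧ (does (w ≟ π k) ∧ f w)))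
    ≡⟨ sum-cong-≗ (λ k → sum-cong-≗ (λ w → regroup k w)) ⟩
  sum (λ k → sum (λ w → (does (π k ≟ w) ∧ g k) ∧ f w))
    ≡⟨ ∑-comm (λ k w → (does (π k ≟ w) ∧ g k) ∧ f w) ⟩
  sum (λ w → sum (λ k → (does (π k ≟ w) ∧ g k) ∧ f w))
    ≡⟨ sum-cong-≗ (λ w → *-distribʳ-sum (f w) (λ k → does (π k ≟ w) ∧ g k)) ⟨
  sum (λ w → sum (λ k → does (π k ≟ w) ∧ g k) ∧ f w) ∎
  where
  regroup : ∀ k w → g k ∧ (does (w ≟ π k) ∧ f w) ≡ (does (π k ≟ w) ∧ g k) ∧ f w
  regroup k w
    rewrite does-⇔ (mk⇔ sym sym) (w ≟ π k) (π k ≟ w)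
    = trans (sym (∧-assoc (g k) _ _)) (cong (_∧ f w) (∧-comm (g k) _))

------------------------------------------------------------------------
-- Decidable propositions

dec-true⁻¹ : ∀ {A : Set} (a? : Dec A) → does a? ≡ true → A
dec-true⁻¹ (yes a) refl = a

------------------------------------------------------------------------
-- The cyclic successor

cyclicSuc-inject₁ : ∀ {n} (i : Fin n) → cyclicSuc (inject₁ i) ≡ suc i
cyclicSuc-inject₁ {n} i = toℕ-injective (begin
  toℕ (cyclicSuc (inject₁ i))        ≡⟨ toℕ-fromℕ< _ ⟩
  ℕ.suc (toℕ (inject₁ i)) % ℕ.suc n  ≡⟨ cong (λ m → ℕ.suc m % ℕ.suc n) (toℕ-inject₁ i) ⟩
  ℕ.suc (toℕ i) % ℕ.suc n            ≡⟨ m<n⇒m%n≡m (ℕ.s≤s (toℕ<n i)) ⟩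
  ℕ.suc (toℕ i)                      ∎)

cyclicSuc-fromℕ : ∀ n → cyclicSuc (fromℕ n) ≡ zero
cyclicSuc-fromℕ n = toℕ-injective (begin
  toℕ (cyclicSuc (fromℕ n))        ≡⟨ toℕ-fromℕ< _ ⟩
  ℕ.suc (toℕ (fromℕ n)) % ℕ.suc n  ≡⟨ cong (λ m → ℕ.suc m % ℕ.suc n) (toℕ-fromℕ n) ⟩
  ℕ.suc n % ℕ.suc n                ≡⟨ n%n≡0 (ℕ.suc n) ⟩
  0                                ∎)

cyclicSuc-surjective : ∀ {n} (i : Fin (ℕ.suc n)) → ∃[ j ] cyclicSuc j ≡ i
cyclicSuc-surjective zero    = fromℕ _ , cyclicSuc-fromℕ _
cyclicSuc-surjective (suc i) = inject₁ i , cyclicSuc-inject₁ i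

cyclicSuc-constant : ∀ {n} {A : Set} (f : Fin (ℕ.suc n) → A) →
                     (∀ i → f (cyclicSuc i) ≡ f i) → ∀ i → f i ≡ f zero
cyclicSuc-constant f step = <-weakInduction _ refl λ i ih →
  trans (cong f (sym (cyclicSuc-inject₁ i))) (trans (step (inject₁ i)) ih)

------------------------------------------------------------------------
-- Relative position of points on a line

-- With respect to positions a < b, a position comes before both, strictly
-- between them, or after both.
data Place {n} (a b p : Fin n) : Set where
  before  : p < a → p < b → Place a b p
  between : a < p → p < b → Place a b p
  after   : a < p → b < p → Place a b p

place : ∀ {n} {a b p : Fin n} → a < b → p ≢ a → p ≢ b → Place a b p
place {a = a} {b} {p} a<b p≢a p≢b with <-cmp p a | <-cmp p b
... | tri≈ _ p≡a _ | _            = contradiction p≡a p≢a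
... | tri< p<a _ _ | _            = before p<a (<-trans p<a a<b)
... | tri> _ _ a<p | tri< p<b _ _ = between a<p p<b
... | tri> _ _ a<p | tri≈ _ p≡b _ = contradiction p≡b p≢b
... | tri> _ _ a<p | tri> _ _ b<p = after a<p b<p

-- The characteristic function of the positions from a (excluded) to b
-- (included), when a is before b.
segment : ∀ {n} (a b : Fin n) → Fin n → GF2
segment a b k = does (k ≤? b) xor does (k ≤? a)

≤?-true : ∀ {n} {i j : Fin n} → i < j → does (i ≤? j) ≡ true
≤?-true i<j = dec-true (_ ≤? _) (ℕ.<⇒≤ i<j)

≤?-false : ∀ {n} {i j : Fin n} → j < i → does (i ≤? j) ≡ false
≤?-false j<i = dec-false (_ ≤? _) (ℕ.<⇒≱ j<i)

≤?-refl : ∀ {n} (i : Fin n) → does (i ≤? i) ≡ true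
≤?-refl i = dec-true (i ≤? i) ℕ.≤-refl

isBetween : ∀ {n} {a b p : Fin n} → Place a b p → GF2
isBetween (before _ _)  = false
isBetween (between _ _) = true
isBetween (after _ _)   = false

segment-place : ∀ {n} {a b p : Fin n} (π : Place a b p) → segment a b p ≡ isBetween π
segment-place (before p<a p<b)  = cong₂ _xor_ (≤?-true p<b) (≤?-true p<a)
segment-place (between a<p p<b) = cong₂ _xor_ (≤?-true p<b) (≤?-false a<p)
segment-place (after a<p b<p)   = cong₂ _xor_ (≤?-false b<p) (≤?-false a<p)

-- The pairs a, b and p, q alternate, when a < b and p < q.
Linked : ∀ {n} (a b p q : Fin n) → Set
Linked a b p q = (a < p × p < b × b < q) ⊎ (p < a × a < q × q < b)

------------------------------------------------------------------------
-- Permutations and filters of lists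

-- The elements of ys can be removed from xs one after the other; xs itself
-- may have repetitions.
Unique-⊆⇒↭-++ : ∀ {A : Set} {xs ys : List A} → Unique ys →
                (∀ {y} → y ∈ˡ ys → y ∈ˡ xs) → ∃[ zs ] xs ↭ ys ++ zs
Unique-⊆⇒↭-++ [] ys⊆xs = _ , ↭-refl
Unique-⊆⇒↭-++ {xs = xs} {ys = y ∷ ys} (y∉ys ∷ uniq) ys⊆xs
  with us , vs , refl ← ∈-∃++ (ys⊆xs (here refl)) =
  let zs , p = Unique-⊆⇒↭-++ uniq ys⊆us++vs in zs , ↭-trans (shift y us vs) (prep y p)
  where
  ys⊆us++vs : ∀ {x} → x ∈ˡ ys → x ∈ˡ us ++ vs
  ys⊆us++vs x∈ys with ∈-resp-↭ (shift y us vs) (ys⊆xs (there x∈ys))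
  ... | here refl = contradiction refl (All.lookup y∉ys x∈ys)
  ... | there x∈  = x∈

Unique-⊆⇒↭ : ∀ {A : Set} {xs ys : List A} → Unique ys →
             (∀ {y} → y ∈ˡ ys → y ∈ˡ xs) → length xs ≡ length ys → xs ↭ ys
Unique-⊆⇒↭ {ys = ys} uniq ys⊆xs eq with Unique-⊆⇒↭-++ uniq ys⊆xs
... | []     , p = ↭-trans p (++-identityʳ ys)
... | z ∷ zs , p = contradiction
  (trans (sym eq) (trans (↭-length p) (length-++ ys)))
  (ℕ.m≢1+m+n (length ys) ∘ λ q → trans q (ℕ.+-suc _ _))

length-filter-∷ : ∀ {A : Set} {R : A → Set} (R? : ∀ a → Dec (R a)) a as →
  length (filter R? (a ∷ as)) ≡ (if does (R? a) then 1 else 0) ℕ.+ length (filter R? as)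
length-filter-∷ R? a as with does (R? a)
... | true  = refl
... | false = refl

-- If R has the same truth value on a and c, and on b and d, then it holds for
-- exactly two of the four when its truth values on a and b differ.
filter-pairs : ∀ {A : Set} {R : A → Set} (R? : ∀ a → Dec (R a)) a b c d →
               does (R? c) ≡ does (R? a) → does (R? d) ≡ does (R? b) →
               does (length (filter R? (a ∷ b ∷ c ∷ d ∷ [])) ℕ.≟ 2) ≡ does (R? a) xor does (R? b)
filter-pairs R? a b c d c≡a d≡b
  rewrite length-filter-∷ R? a (b ∷ c ∷ d ∷ []) | length-filter-∷ R? b (c ∷ d ∷ [])
        | length-filter-∷ R? c (d ∷ []) | length-filter-∷ R? d [] | c≡a | d≡b
  = pairs (does (R? a)) (does (R? b))
  where
  bit : Bool → ℕ
  bit β = if β then 1 else 0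

  pairs : ∀ α β → does (bit α ℕ.+ (bit β ℕ.+ (bit α ℕ.+ (bit β ℕ.+ 0))) ℕ.≟ 2) ≡ α xor β
  pairs false false = refl
  pairs false true  = refl
  pairs true  false = refl
  pairs true  true  = refl

------------------------------------------------------------------------
-- Half-edges

module _ (F : Multigraph) where
  open Multigraph F

  opposite-involutive : ∀ h → opposite (opposite h) ≡ h
  opposite-involutive (e , b) = cong (e ,_) (not-involutive b)

  edge-determines : ∀ h h′ → edge h ≡ edge h′ → h ≡ h′ ⊎ h ≡ opposite h′
  edge-determines (e , false) (_ , false) refl = inj₁ refl
  edge-determines (e , false) (_ , true)  refl = inj₂ refl
  edge-determines (e , true)  (_ , false) refl = inj₂ refl
  edge-determines (e , true)  (_ , true)  refl = inj₁ refl

  ∈-halfEdgesAt : ∀ h → h ∈ˡ halfEdgesAt (vertex h)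
  ∈-halfEdgesAt (e , b) = ∈-filter⁺ _ (∈-cartesianProduct⁺ (∈-allFin e) (∈-both b)) refl
    where
    ∈-both : ∀ b → b ∈ˡ false ∷ true ∷ []
    ∈-both false = here refl
    ∈-both true  = there (here refl)

  halfEdgesAt-vertex : ∀ {v h} → h ∈ˡ halfEdgesAt v → vertex h ≡ v
  halfEdgesAt-vertex {v} h∈ = proj₂ (∈-filter⁻ (λ h → vertex h ≟ v)
    {xs = cartesianProduct (allFin #E) (false ∷ true ∷ [])} h∈)

  halfEdgesAt-unique : ∀ v → Unique (halfEdgesAt v)
  halfEdgesAt-unique v = filter⁺ _
    (cartesianProduct⁺ (allFin⁺ #E) (((λ ()) ∷ []) ∷ [] ∷ []))

  all-halfEdgesAt : ∀ {v} {R : HalfEdge → Set} → (∀ h → vertex h ≡ v → R h) →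
                    All R (halfEdgesAt v)
  all-halfEdgesAt r = All.tabulate (λ {h} h∈ → r h (halfEdgesAt-vertex h∈))

  at-halfEdgesAt : ∀ {R : HalfEdge → Set} {v} → All R (halfEdgesAt v) →
                   ∀ h → vertex h ≡ v → R h
  at-halfEdgesAt rs h refl = All.lookup rs (∈-halfEdgesAt h)

------------------------------------------------------------------------
-- Circuit partitions

module Partition {F : Multigraph} (D : CircuitPartition F) where
  open Multigraph F
  open CircuitPartition D public
  module Circuits (γ : Fin size) = Circuit (circuit γ)
  open Circuits public using (length-1; Position; out; at)

  -- The unique circuit that contains the edge of h, and the position at which
  -- it traverses that edge.
  circuitOf : HalfEdge → Fin size
  circuitOf h = proj₁ (partition (edge h))

  position : ∀ h → Position (circuitOf h)
  position h = proj₁ (proj₁ (proj₂ (partition (edge h))))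

  edge-position : ∀ h → edge (out (circuitOf h) (position h)) ≡ edge h
  edge-position h = proj₂ (proj₁ (proj₂ (partition (edge h))))

  circuitOf-unique : ∀ {γ} h → Circuit.ContainsEdge (circuit γ) (edge h) → circuitOf h ≡ γ
  circuitOf-unique h = proj₂ (proj₂ (partition (edge h)))

  circuitOf-out : ∀ γ i → circuitOf (out γ i) ≡ γ
  circuitOf-out γ i = circuitOf-unique (out γ i) (i , refl)

  circuitOf-opposite-out : ∀ γ i → circuitOf (opposite (out γ i)) ≡ γ
  circuitOf-opposite-out γ i = circuitOf-unique (out γ i) (i , refl)

  out-injective : ∀ {γ} {i j : Position γ} → out γ i ≡ out γ j → i ≡ j
  out-injective {γ} eq = Circuit.trail (circuit γ) (cong edge eq)

  -- Every half-edge occurs in the written circuits, either as the one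
  -- through which a step leaves a vertex or as the one through which it
  -- arrives.
  data Occurrence : HalfEdge → Set where
    leaving  : ∀ γ i → Occurrence (out γ i)
    arriving : ∀ γ i → Occurrence (opposite (out γ i))

  occurrence : ∀ h → Occurrence h
  occurrence h with edge-determines F h _ (sym (edge-position h))
  ... | inj₁ eq = subst Occurrence (sym eq) (leaving _ _)
  ... | inj₂ eq = subst Occurrence (sym eq) (arriving _ _)

  partner-leaving : ∀ γ i → partner (out γ (cyclicSuc i)) ≡ opposite (out γ i)
  partner-leaving γ i =
    trans (cong partner (sym (follows γ i))) (partner-involutive _)

  circuitOf-partner : ∀ h → circuitOf (partner h) ≡ circuitOf h
  circuitOf-partner h with occurrence h
  ... | arriving γ i = trans (cong circuitOf (follows γ i))
                             (trans (circuitOf-out γ _) (sym (circuitOf-opposite-out γ i)))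
  ... | leaving γ i with j , refl ← cyclicSuc-surjective i =
    trans (cong circuitOf (partner-leaving γ j))
          (trans (circuitOf-opposite-out γ j) (sym (circuitOf-out γ _)))

  -- A function on half-edges that does not see the difference between the
  -- two halves of an edge nor between two half-edges paired by the chosen
  -- transitions is constant on each circuit.
  constantOnCircuits :
    ∀ {A : Set} (f : HalfEdge → A) → (∀ h → f (opposite h) ≡ f h) →
    (∀ h → f (partner h) ≡ f h) → ∀ h → f h ≡ f (out (circuitOf h) zero)
  constantOnCircuits f opp par h with occurrence h
  ... | leaving γ i rewrite circuitOf-out γ i = cyclicSuc-constant (f ∘ out γ)
    (λ j → trans (cong f (sym (follows γ j))) (trans (par _) (opp _))) i
  ... | arriving γ i rewrite circuitOf-opposite-out γ i = trans (opp _)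
    (cyclicSuc-constant (f ∘ out γ)
      (λ j → trans (cong f (sym (follows γ j))) (trans (par _) (opp _))) i)

  -- The characteristic function of the edges of γ.
  onCircuit : Fin size → HalfEdge → GF2
  onCircuit γ h = does (Circuit.containsEdge? (circuit γ) (edge h))

  onCircuit-circuitOf : ∀ γ h → onCircuit γ h ≡ does (γ ≟ circuitOf h)
  onCircuit-circuitOf γ h = does-⇔
    (mk⇔ (sym ∘ circuitOf-unique h) λ { refl → position h , edge-position h })
    (Circuit.containsEdge? (circuit γ) (edge h)) (γ ≟ circuitOf h)

  onCircuit-partner : ∀ γ h → onCircuit γ (partner h) ≡ onCircuit γ h
  onCircuit-partner γ h = begin
    onCircuit γ (partner h)            ≡⟨ onCircuit-circuitOf γ (partner h) ⟩
    does (γ ≟ circuitOf (partner h))   ≡⟨ cong (λ δ → does (γ ≟ δ)) (circuitOf-partner h) ⟩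
    does (γ ≟ circuitOf h)             ≡⟨ onCircuit-circuitOf γ h ⟨
    onCircuit γ h                      ∎

  -- A combination of characteristic functions of circuits takes on each
  -- circuit the value of its coefficient.
  sum-onCircuit : ∀ (c : Vector GF2 size) h →
                  sum (λ γ → c γ ∧ onCircuit γ h) ≡ c (circuitOf h)
  sum-onCircuit c h = trans (sum-cong-≗ λ γ → cong (c γ ∧_) (onCircuit-circuitOf γ h))
                            (sum-δʳ (circuitOf h) c)

  -- The orientation of the written circuits: true on the half-edges
  -- directed out of their vertex and false on those directed into it.
  outward : HalfEdge → Bool
  outward h = does (outDirected? F D h)

  outward-leaving : ∀ γ i → outward (out γ i) ≡ true
  outward-leaving γ i = dec-true (outDirected? F D _) (γ , i , refl)

  -- No edge is traversed in both directions.
  opposite-out≢out : ∀ {γ i γ′ i′} → out γ′ i′ ≢ opposite (out γ i)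
  opposite-out≢out {γ} {i} {γ′} {i′} eq
    with refl ← trans (sym (circuitOf-out γ′ i′)) (trans (cong circuitOf eq) (circuitOf-opposite-out γ i))
    with refl ← Circuit.trail (circuit γ) (cong edge eq)
    = not-¬ {proj₂ (out γ i)} refl (cong proj₂ eq)

  outward-arriving : ∀ γ i → outward (opposite (out γ i)) ≡ false
  outward-arriving γ i =
    dec-false (outDirected? F D _) λ (γ′ , i′ , eq) → opposite-out≢out eq

  outward-opposite : ∀ h → outward (opposite h) ≡ not (outward h)
  outward-opposite h with occurrence h
  ... | leaving γ i  = trans (outward-arriving γ i) (cong not (sym (outward-leaving γ i)))
  ... | arriving γ i = trans (cong outward (opposite-involutive F (out γ i)))
    (trans (outward-leaving γ i) (cong not (sym (outward-arriving γ i))))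

  outward-partner : ∀ h → outward (partner h) ≡ not (outward h)
  outward-partner h with occurrence h
  ... | arriving γ i = trans (cong outward (follows γ i))
    (trans (outward-leaving γ _) (cong not (sym (outward-arriving γ i))))
  ... | leaving γ i with j , refl ← cyclicSuc-surjective i =
    trans (cong outward (partner-leaving γ j))
      (trans (outward-arriving γ j) (cong not (sym (outward-leaving γ _))))

  outward⇒leaving : ∀ h → outward h ≡ true → ∃[ γ ] ∃[ i ] out γ i ≡ h
  outward⇒leaving h eq with occurrence h
  ... | leaving γ i  = γ , i , refl
  ... | arriving γ i = contradiction (trans (sym eq) (outward-arriving γ i)) λ ()

  -- A component contains either all vertices of a circuit or none of them.
  incident⇔vertex∈ : ∀ {K} → IsComponent K → ∀ h → Incident K (circuitOf h) ⇔ vertex h ∈ K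
  incident⇔vertex∈ {K} K-component@(r , K⇔) h = mk⇔ to from
    where
    closed : ∀ h → vertex h ∈ K → vertex (opposite h) ∈ K
    closed h h∈K = Equivalence.from (K⇔ _)
      (Equivalence.to (K⇔ _) h∈K ◅◅ ((h , refl , refl) ◅ ε))

    vertexInK : HalfEdge → Bool
    vertexInK h = does (vertex h ∈? K)

    vertexInK-opposite : ∀ h → vertexInK (opposite h) ≡ vertexInK h
    vertexInK-opposite h = does-⇔
      (mk⇔ (subst (λ h → vertex h ∈ K) (opposite-involutive F h) ∘ closed (opposite h)) (closed h))
      (vertex (opposite h) ∈? K) (vertex h ∈? K)

    vertexInK-partner : ∀ h → vertexInK (partner h) ≡ vertexInK h
    vertexInK-partner h = cong (λ v → does (v ∈? K)) (partner-vertex h)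

    vertexInK-constant : ∀ h → vertexInK h ≡ vertexInK (out (circuitOf h) zero)
    vertexInK-constant = constantOnCircuits vertexInK vertexInK-opposite vertexInK-partner

    to : Incident K (circuitOf h) → vertex h ∈ K
    to (i , i∈K) = dec-true⁻¹ (vertex h ∈? K) (begin
      vertexInK h                                   ≡⟨ vertexInK-constant h ⟩
      vertexInK (out (circuitOf h) zero)            ≡⟨ cong (λ γ → vertexInK (out γ zero)) (circuitOf-out _ i) ⟨
      vertexInK (out (circuitOf (out (circuitOf h) i)) zero)
                                                    ≡⟨ vertexInK-constant (out (circuitOf h) i) ⟨
      vertexInK (out (circuitOf h) i)               ≡⟨ dec-true (_ ∈? K) i∈K ⟩
      true                                          ∎)

    from : vertex h ∈ K → Incident K (circuitOf h)
    from h∈K with occurrence h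
    ... | leaving γ i  = subst (Incident K) (sym (circuitOf-out γ i)) (i , h∈K)
    ... | arriving γ i = subst (Incident K) (sym (circuitOf-opposite-out γ i))
      (i , subst (λ h → vertex h ∈ K) (opposite-involutive F (out γ i)) (closed _ h∈K))

------------------------------------------------------------------------
-- Four half-edges at a vertex

module FourHalfEdges (F : Multigraph) (4-regular : FourRegular F) where
  open Multigraph F

  halfEdgeAt : ∀ v → ∃[ h ] vertex h ≡ v
  halfEdgeAt v = nonempty (halfEdgesAt v) (4-regular v) halfEdgesAt-vertex′
    where
    halfEdgesAt-vertex′ : ∀ {h} → h ∈ˡ halfEdgesAt v → vertex h ≡ v
    halfEdgesAt-vertex′ = halfEdgesAt-vertex F

    nonempty : ∀ hs → length hs ≡ 4 → (∀ {h} → h ∈ˡ hs → vertex h ≡ v) → ∃[ h ] vertex h ≡ v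
    nonempty (h ∷ _) _ at-v = h , at-v (here refl)

  atEveryVertex : (R : Vertex → Set) → (∀ h → R (vertex h)) → ∀ v → R v
  atEveryVertex R r v = let h , h-v = halfEdgeAt v in subst R h-v (r h)

  module _ (τ : TransitionChoice F) where
    open TransitionChoice τ

    partner-injective : ∀ {h h′} → partner h ≡ partner h′ → h ≡ h′
    partner-injective eq =
      trans (sym (partner-involutive _)) (trans (cong partner eq) (partner-involutive _))

    -- Two different pairs are disjoint.
    pair-distinct : ∀ {g h o} → h ≢ o → h ≢ partner o → g ≡ h ⊎ g ≡ partner h →
                    g ≢ o × g ≢ partner o
    pair-distinct h≢o h≢po (inj₁ refl) = h≢o , h≢po
    pair-distinct h≢o h≢po (inj₂ refl) =
      (λ eq → h≢po (trans (sym (partner-involutive _)) (cong partner eq))) ,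
      h≢o ∘ partner-injective

    twoPairs : ∀ {h h′} → vertex h′ ≡ vertex h → h′ ≢ h → h′ ≢ partner h →
               halfEdgesAt (vertex h) ↭ h ∷ partner h ∷ h′ ∷ partner h′ ∷ []
    twoPairs {h} {h′} same-vertex h′≢h h′≢partner =
      Unique-⊆⇒↭ unique incident (4-regular (vertex h))
      where
      unique : Unique (h ∷ partner h ∷ h′ ∷ partner h′ ∷ [])
      unique =
        (partner-distinct h ∘ sym ∷ h′≢h ∘ sym ∷
          (λ eq → h′≢partner (trans (sym (partner-involutive h′)) (cong partner (sym eq)))) ∷ []) ∷
        (h′≢partner ∘ sym ∷ h′≢h ∘ sym ∘ partner-injective ∷ []) ∷
        (partner-distinct h′ ∘ sym ∷ []) ∷ [] ∷ []

      atVertex : ∀ h′ → vertex h′ ≡ vertex h → h′ ∈ˡ halfEdgesAt (vertex h)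
      atVertex h′ eq = subst (λ v → h′ ∈ˡ halfEdgesAt v) eq (∈-halfEdgesAt F h′)

      incident : ∀ {g} → g ∈ˡ h ∷ partner h ∷ h′ ∷ partner h′ ∷ [] → g ∈ˡ halfEdgesAt (vertex h)
      incident (here refl)                         = atVertex _ refl
      incident (there (here refl))                 = atVertex _ (partner-vertex h)
      incident (there (there (here refl)))         = atVertex _ same-vertex
      incident (there (there (there (here refl)))) = atVertex _ (trans (partner-vertex h′) same-vertex)

    otherPair : ∀ h → ∃[ h′ ] vertex h′ ≡ vertex h × h′ ≢ h × h′ ≢ partner h
    otherPair h with any? (λ h′ → ¬? (h′ ≟ʰ h) ×-dec ¬? (h′ ≟ʰ partner h)) (halfEdgesAt (vertex h))
    ... | yes found = let h′ , h′∈ , distinct = find found in h′ , halfEdgesAt-vertex F h′∈ , distinct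
    ... | no ¬found =
      let rest , perm = Unique-⊆⇒↭-++ {xs = h ∷ partner h ∷ []} (halfEdgesAt-unique F (vertex h)) only-two
      in contradiction
           (trans (↭-length perm) (trans (length-++ (halfEdgesAt (vertex h)))
             (cong (ℕ._+ length rest) (4-regular (vertex h)))))
           λ ()
      where
      only-two : ∀ {g} → g ∈ˡ halfEdgesAt (vertex h) → g ∈ˡ h ∷ partner h ∷ []
      only-two {g} g∈ with g ≟ʰ h | g ≟ʰ partner h
      ... | yes eq | _      = here eq
      ... | no _   | yes eq = there (here eq)
      ... | no ≢h  | no ≢p  = contradiction (lose g∈ (≢h , ≢p)) ¬found

  -- Two choices of transitions that disagree at h pair the four half-edges at
  -- its vertex like the two generators of a Klein four-group.
  module _ (σ τ : TransitionChoice F) where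
    private
      module σ = TransitionChoice σ
      module τ = TransitionChoice τ

    commuting : ∀ {h} → σ.partner h ≢ τ.partner h →
                halfEdgesAt (vertex h) ↭
                  h ∷ τ.partner h ∷ σ.partner h ∷ σ.partner (τ.partner h) ∷ [] ×
                σ.partner (τ.partner h) ≡ τ.partner (σ.partner h)
    commuting {h} σh≢τh =
      let perm = twoPairs τ {h} {σ.partner h} (σ.partner-vertex h) (σ.partner-distinct h) σh≢τh
          commute = case ∈-resp-↭ perm στh∈ of λ where
            (here eq) → contradiction (trans (cong σ.partner (sym eq)) (σ.partner-involutive _)) σh≢τh
            (there (here eq)) → contradiction eq (σ.partner-distinct _)
            (there (there (here eq))) → contradiction (partner-injective σ eq) (τ.partner-distinct h)
            (there (there (there (here eq)))) → eq
      in subst (λ g → _ ↭ h ∷ τ.partner h ∷ σ.partner h ∷ g ∷ []) (sym commute) perm , commute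
      where
      στh∈ : σ.partner (τ.partner h) ∈ˡ halfEdgesAt (vertex h)
      στh∈ = subst (λ v → _ ∈ˡ halfEdgesAt v)
        (trans (σ.partner-vertex _) (τ.partner-vertex h)) (∈-halfEdgesAt F _)

------------------------------------------------------------------------
-- The two visits of an Euler system at a vertex

-- The component of v exists up to double negation.  A decision procedure for
-- connectedness is not needed, as the existence of components is used only
-- for stable conclusions.
component : ∀ F v → ¬ ¬ (∃[ K ] (∀ w → w ∈ K ⇔ Multigraph.Connected F v w))
component F v = ¬¬-map build (sequence (RawMonad.rawApplicative ¬¬-Monad) λ w → ¬¬-excluded-middle)
  where
  open Multigraph F
  build : (∀ w → Dec (Connected v w)) → ∃[ K ] (∀ w → w ∈ K ⇔ Connected v w)
  build connected? = K , λ w → mk⇔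
    (λ w∈K → dec-true⁻¹ (connected? w) (trans (sym (lookup∘tabulate _ w)) ([]=⇒lookup w∈K)))
    (λ conn → lookup⇒[]= w K (trans (lookup∘tabulate _ w) (dec-true (connected? w) conn)))
    where
    K : Subset #V
    K = tabulate (does ∘ connected?)

module EulerSystem (F : Multigraph) (4-regular : FourRegular F)
                   (C : CircuitPartition F) (euler : IsEulerSystem F C) where
  open Multigraph F
  open Partition C
  open FourHalfEdges F 4-regular

  component-circuitOf : ∀ {K} → IsComponent K → ∀ h h′ → vertex h ∈ K → vertex h′ ∈ K →
                        circuitOf h ≡ circuitOf h′
  component-circuitOf {K} K-component h h′ h∈K h′∈K =
    trans (sym (unique (incident h h∈K))) (unique (incident h′ h′∈K))
    where
    unique : ∀ {γ} → Incident K γ → proj₁ (euler K K-component) ≡ γ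
    unique = proj₂ (proj₂ (euler K K-component))
    incident : ∀ h → vertex h ∈ K → Incident K (circuitOf h)
    incident h = Equivalence.from (incident⇔vertex∈ K-component h)

  -- Both passes through a vertex belong to the same circuit of C.
  vertex-circuitOf : ∀ h h′ → vertex h ≡ vertex h′ → circuitOf h ≡ circuitOf h′
  vertex-circuitOf h h′ eq = decidable-stable (circuitOf h ≟ circuitOf h′)
    (¬¬-map (λ (K , K⇔) → component-circuitOf (vertex h , K⇔) h h′
        (Equivalence.from (K⇔ _) ε) (subst (_∈ K) eq (Equivalence.from (K⇔ _) ε)))
      (component F (vertex h)))

  -- The Euler system passes the vertex v exactly twice, at the positions
  -- a < b of its circuit γ.
  record Visits (v : Vertex) (γ : Fin size) (a b : Position γ) : Set where
    field
      a<b  : a < b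
      at-a : at γ a ≡ v
      at-b : at γ b ≡ v
      only : ∀ δ k → at δ k ≡ v → out δ k ≡ out γ a ⊎ out δ k ≡ out γ b

    sameCircuit : ∀ {δ k} → at δ k ≡ v → δ ≡ γ
    sameCircuit {δ} {k} eq =
      trans (sym (circuitOf-out δ k)) (trans (circuitOf-≡ (only δ k eq)) (circuitOf-out γ a))
      where
      circuitOf-≡ : out δ k ≡ out γ a ⊎ out δ k ≡ out γ b → circuitOf (out δ k) ≡ circuitOf (out γ a)
      circuitOf-≡ (inj₁ eq) = cong circuitOf eq
      circuitOf-≡ (inj₂ eq) = trans (cong circuitOf eq)
        (trans (circuitOf-out γ b) (sym (circuitOf-out γ a)))

    a-or-b : ∀ {k} → at γ k ≡ v → k ≡ a ⊎ k ≡ b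
    a-or-b eq = Sum.map out-injective out-injective (only γ _ eq)

    b≢a : b ≢ a
    b≢a eq = <-irrefl (sym eq) a<b

    first-second : ∀ {i k} → at γ i ≡ v → at γ k ≡ v → i < k → i ≡ a × k ≡ b
    first-second i-v k-v i<k with a-or-b i-v | a-or-b k-v
    ... | inj₁ refl | inj₂ refl = refl , refl
    ... | inj₁ refl | inj₁ refl = contradiction i<k (<-irrefl refl)
    ... | inj₂ refl | inj₂ refl = contradiction i<k (<-irrefl refl)
    ... | inj₂ refl | inj₁ refl = contradiction i<k (<-asym a<b)

  -- Of the two half-edges paired by C one is directed out of the vertex.
  leavingPair : ∀ h → ∃[ γ ] ∃[ i ] (out γ i ≡ h ⊎ out γ i ≡ partner h)
  leavingPair h with occurrence h
  ... | leaving γ i  = γ , i , inj₁ refl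
  ... | arriving γ i = γ , cyclicSuc i , inj₂ (sym (follows γ i))

  leaving≢partner : ∀ {γ i δ j} → out δ j ≢ partner (out γ i)
  leaving≢partner {γ} {i} {δ} {j} eq = contradiction (begin
    true                         ≡⟨ outward-leaving δ j ⟨
    outward (out δ j)            ≡⟨ cong outward eq ⟩
    outward (partner (out γ i))  ≡⟨ outward-partner (out γ i) ⟩
    not (outward (out γ i))      ≡⟨ cong not (outward-leaving γ i) ⟩
    false                        ∎) λ ()

  visits : ∀ v → ∃[ γ ] ∃[ a ] ∃[ b ] Visits v γ a b
  visits v
    with h₀ , refl ← halfEdgeAt v
    with γ , a , a≡ ← leavingPair h₀
    with h , h-vertex , h≢ , h≢partner ← otherPair transitions (out γ a)
    with δ , b , b≡ ← leavingPair h
    = ordered δ≡γ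
    where
    o₁ = out γ a
    o₂ = out δ b

    atPair : ∀ {g h} → g ≡ h ⊎ g ≡ partner h → vertex g ≡ vertex h
    atPair (inj₁ refl) = refl
    atPair (inj₂ refl) = partner-vertex _

    o₁-vertex : vertex o₁ ≡ vertex h₀
    o₁-vertex = atPair a≡

    o₂-vertex : vertex o₂ ≡ vertex o₁
    o₂-vertex = trans (atPair b≡) h-vertex

    o₂≢o₁ : o₂ ≢ o₁
    o₂≢o₁ = proj₁ (pair-distinct transitions h≢ h≢partner b≡)

    o₂≢partner : o₂ ≢ partner o₁
    o₂≢partner = proj₂ (pair-distinct transitions h≢ h≢partner b≡)

    δ≡γ : δ ≡ γ
    δ≡γ = trans (sym (circuitOf-out δ b))
      (trans (vertex-circuitOf o₂ o₁ o₂-vertex) (circuitOf-out γ a))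

    only₁₂ : ∀ η k → at η k ≡ vertex h₀ → out η k ≡ o₁ ⊎ out η k ≡ o₂
    only₁₂ η k eq with ∈-resp-↭ (twoPairs transitions o₂-vertex o₂≢o₁ o₂≢partner)
      (subst (λ v → out η k ∈ˡ halfEdgesAt v) (trans eq (sym o₁-vertex)) (∈-halfEdgesAt F (out η k)))
    ... | here e                          = inj₁ e
    ... | there (here e)                  = contradiction e leaving≢partner
    ... | there (there (here e))          = inj₂ e
    ... | there (there (there (here e)))  = contradiction e leaving≢partner

    ordered : δ ≡ γ → ∃[ γ ] ∃[ a ] ∃[ b ] Visits (vertex h₀) γ a b
    ordered refl with <-cmp a b
    ... | tri< a<b _ _ = γ , a , b , record
      { a<b = a<b ; at-a = o₁-vertex ; at-b = trans o₂-vertex o₁-vertex ; only = only₁₂ }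
    ... | tri> _ _ b<a = γ , b , a , record
      { a<b = b<a ; at-a = trans o₂-vertex o₁-vertex ; at-b = o₁-vertex
      ; only = λ η k eq → Sum.swap (only₁₂ η k eq) }
    ... | tri≈ _ refl _ = contradiction refl o₂≢o₁

  -- Sums over the passes of a circuit through w.
  sum-visits : ∀ {w γ p q} → Visits w γ p q → (g : Position γ → GF2) →
               sum (λ k → does (at γ k ≟ w) ∧ g k) ≡ g p xor g q
  sum-visits {w} {γ} {p} {q} w-visits g = begin
    sum (λ k → does (at γ k ≟ w) ∧ g k)
      ≡⟨ sum-xor-∧ {d = λ k → does (k ≟ p)} {λ k → does (k ≟ q)} g passes ⟩
    sum (λ k → does (k ≟ p) ∧ g k) xor sum (λ k → does (k ≟ q) ∧ g k)
      ≡⟨ cong₂ _xor_ (sum-δ p g) (sum-δ q g) ⟩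
    g p xor g q ∎
    where
    open Visits w-visits
    passes : ∀ k → does (at γ k ≟ w) ≡ does (k ≟ p) xor does (k ≟ q)
    passes k with k ≟ p
    ... | yes refl = trans (dec-true (at γ k ≟ w) at-a)
                           (cong not (sym (dec-false (k ≟ q) (b≢a ∘ sym))))
    ... | no k≢p with k ≟ q
    ...   | yes refl = dec-true (at γ k ≟ w) at-b
    ...   | no k≢q   = dec-false (at γ k ≟ w) λ eq → case a-or-b eq of λ where
      (inj₁ k≡p) → k≢p k≡p
      (inj₂ k≡q) → k≢q k≡q

  sum-no-visits : ∀ {w δ p q γ} → Visits w δ p q → γ ≢ δ → (g : Position γ → GF2) →
                  sum (λ k → does (at γ k ≟ w) ∧ g k) ≡ false
  sum-no-visits w-visits γ≢δ g = sum-0 λ k →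
    cong (_∧ g k) (dec-false (_ ≟ _) (γ≢δ ∘ Visits.sameCircuit w-visits {k = k}))

------------------------------------------------------------------------
-- Interlacement

  interlaces⇒linked : ∀ {v w γ a b p q} → Visits v γ a b → Visits w γ p q →
                      ∀ {δ} → Circuit.Interlaces (circuit δ) v w → Linked a b p q
  interlaces⇒linked v-visits w-visits (i , j , k , l , (i<j , j<k , k<l) , inj₁ (iv , jw , kv , lw))
    with refl ← Visits.sameCircuit v-visits iv
    with refl , refl ← Visits.first-second v-visits iv kv (<-trans i<j j<k)
    with refl , refl ← Visits.first-second w-visits jw lw (<-trans j<k k<l)
    = inj₁ (i<j , j<k , k<l)
  interlaces⇒linked v-visits w-visits (i , j , k , l , (i<j , j<k , k<l) , inj₂ (iw , jv , kw , lv))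
    with refl ← Visits.sameCircuit w-visits iw
    with refl , refl ← Visits.first-second w-visits iw kw (<-trans i<j j<k)
    with refl , refl ← Visits.first-second v-visits jv lv (<-trans j<k k<l)
    = inj₂ (i<j , j<k , k<l)

  linked⇒interlaces : ∀ {v w γ a b p q} → Visits v γ a b → Visits w γ p q →
                      Linked a b p q → Circuit.Interlaces (circuit γ) v w
  linked⇒interlaces v-visits w-visits (inj₁ (a<p , p<b , b<q)) =
    _ , _ , _ , _ , (a<p , p<b , b<q) , inj₁ (V.at-a , W.at-a , V.at-b , W.at-b)
    where
    module V = Visits v-visits
    module W = Visits w-visits
  linked⇒interlaces v-visits w-visits (inj₂ (p<a , a<q , q<b)) =
    _ , _ , _ , _ , (p<a , a<q , q<b) , inj₂ (W.at-a , V.at-a , W.at-b , V.at-b)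
    where
    module V = Visits v-visits
    module W = Visits w-visits

  -- Two distinct vertices on the same circuit are interlaced exactly when one
  -- of the two passes through w, and not the other, lies between those
  -- through v.
  interlacement-parity : ∀ {v w γ a b p q} → v ≢ w → Visits v γ a b → Visits w γ p q →
                         segment a b p xor segment a b q ≡ interlacement F C v w
  interlacement-parity {v} {w} {γ} {a} {b} {p} {q} v≢w v-visits w-visits =
    trans (cong₂ _xor_ (segment-place (placeOf W.at-a)) (segment-place (placeOf W.at-b)))
          (parity (placeOf W.at-a) (placeOf W.at-b))
    where
    module V = Visits v-visits
    module W = Visits w-visits

    placeOf : ∀ {k} → at γ k ≡ w → Place a b k
    placeOf k-w = place V.a<b (λ { refl → v≢w (trans (sym V.at-a) k-w) })
                              (λ { refl → v≢w (trans (sym V.at-b) k-w) })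

    linked : Linked a b p q → true ≡ interlacement F C v w
    linked link = sym (dec-true (interlaced? F C v w)
      (v≢w , γ , linked⇒interlaces v-visits w-visits link))

    unlinked : ¬ Linked a b p q → false ≡ interlacement F C v w
    unlinked ¬link = sym (dec-false (interlaced? F C v w)
      λ (_ , δ , inter) → ¬link (interlaces⇒linked v-visits w-visits {δ} inter))

    parity : (π : Place a b p) (κ : Place a b q) → isBetween π xor isBetween κ ≡ interlacement F C v w
    parity (before p<a _)    (between a<q q<b) = linked (inj₂ (p<a , a<q , q<b))
    parity (between a<p p<b) (after _ b<q)     = linked (inj₁ (a<p , p<b , b<q))
    parity (between a<p _)   (before q<a _)    = contradiction (<-trans q<a a<p) (<-asym W.a<b)
    parity (after _ b<p)     (between _ q<b)   = contradiction (<-trans q<b b<p) (<-asym W.a<b)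
    parity (before p<a p<b)  (before q<a _)    = unlinked λ where
      (inj₁ (a<p , _))     → <-asym a<p p<a
      (inj₂ (_ , a<q , _)) → <-asym a<q q<a
    parity (before p<a p<b)  (after _ b<q)     = unlinked λ where
      (inj₁ (a<p , _))     → <-asym a<p p<a
      (inj₂ (_ , _ , q<b)) → <-asym q<b b<q
    parity (between a<p p<b) (between _ q<b)   = unlinked λ where
      (inj₁ (_ , _ , b<q)) → <-asym b<q q<b
      (inj₂ (p<a , _))     → <-asym p<a a<p
    parity (after a<p b<p)   (before _ _)      = unlinked λ where
      (inj₁ (_ , p<b , _)) → <-asym p<b b<p
      (inj₂ (p<a , _))     → <-asym p<a a<p
    parity (after a<p b<p)   (after _ _)       = unlinked λ where
      (inj₁ (_ , p<b , _)) → <-asym p<b b<p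
      (inj₂ (p<a , _))     → <-asym p<a a<p

  -- The passes after the first visit of v, up to and including the second one,
  -- meet v once and every other vertex w with the parity of its interlacement
  -- with v.
  segment-count : ∀ {v γ a b} → Visits v γ a b → ∀ w →
                  sum (λ k → does (at γ k ≟ w) ∧ segment a b k) ≡
                  does (w ≟ v) xor interlacement F C v w
  segment-count {v} {γ} {a} {b} v-visits w = count (w ≟ v)
    where
    module V = Visits v-visits

    distinct : w ≢ v → ∀ {δ p q} → Visits w δ p q → Dec (γ ≡ δ) →
               sum (λ k → does (at γ k ≟ w) ∧ segment a b k) ≡ interlacement F C v w
    distinct w≢v w-visits (yes refl) = trans (sum-visits w-visits (segment a b))
      (interlacement-parity (w≢v ∘ sym) v-visits w-visits)
    distinct w≢v w-visits (no γ≢δ) = trans (sum-no-visits w-visits γ≢δ (segment a b))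
      (sym (dec-false (interlaced? F C v w) λ where
        (_ , η , i , j , k , l , _ , inj₁ (iv , jw , _)) → γ≢δ
          (trans (sym (V.sameCircuit iv)) (Visits.sameCircuit w-visits jw))
        (_ , η , i , j , k , l , _ , inj₂ (iw , jv , _)) → γ≢δ
          (trans (sym (V.sameCircuit jv)) (Visits.sameCircuit w-visits iw))))

    count : (w≟v : Dec (w ≡ v)) → sum (λ k → does (at γ k ≟ w) ∧ segment a b k) ≡
                                  does w≟v xor interlacement F C v w
    count (yes refl) = begin
      sum (λ k → does (at γ k ≟ v) ∧ segment a b k)
        ≡⟨ sum-visits v-visits (segment a b) ⟩
      segment a b a xor segment a b b
        ≡⟨ cong₂ _xor_ (cong₂ _xor_ (≤?-true V.a<b) (≤?-refl a))
                       (cong₂ _xor_ (≤?-refl b) (≤?-false V.a<b)) ⟩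
      true
        ≡⟨ cong not (dec-false (interlaced? F C v v) λ (v≢v , _) → v≢v refl) ⟨
      true xor interlacement F C v v ∎
    count (no w≢v) = let δ , _ , _ , w-visits = visits w in distinct w≢v w-visits (γ ≟ δ)

------------------------------------------------------------------------
-- Edge labellings with prescribed jumps along the Euler system

  -- z is a GF(2)-labelling of the edges, regarded as a function on
  -- half-edges, whose value changes by x v at each pass of the Euler system
  -- through v.
  record JumpsBy (x : Vector GF2 #V) (z : HalfEdge → GF2) : Set where
    field
      onEdges : ∀ h → z (opposite h) ≡ z h
      jump    : ∀ h → z (partner h) ≡ z h xor x (vertex h)

  -- The sum of x over the positions of γ up to and including i.
  prefixSum : Vector GF2 #V → ∀ γ → Position γ → GF2
  prefixSum x γ i = sum λ k → does (k ≤? i) ∧ x (at γ k)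

  prefixSum-suc : ∀ x γ (i : Fin (length-1 γ)) →
                  prefixSum x γ (suc i) ≡ prefixSum x γ (inject₁ i) xor x (at γ (suc i))
  prefixSum-suc x γ i = begin
    prefixSum x γ (suc i)
      ≡⟨ sum-xor-∧ {d = λ k → does (k ≤? inject₁ i)} {λ k → does (k ≟ suc i)} (x ∘ at γ) split ⟩
    prefixSum x γ (inject₁ i) xor sum (λ k → does (k ≟ suc i) ∧ x (at γ k))
      ≡⟨ cong (prefixSum x γ (inject₁ i) xor_) (sum-δ (suc i) (x ∘ at γ)) ⟩
    prefixSum x γ (inject₁ i) xor x (at γ (suc i)) ∎
    where
    i<suc : inject₁ i < suc i
    i<suc = ℕ.s≤s (ℕ.≤-reflexive (toℕ-inject₁ i))

    split : ∀ k → does (k ≤? suc i) ≡ does (k ≤? inject₁ i) xor does (k ≟ suc i)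
    split k with <-cmp k (suc i)
    ... | tri< k<suc k≢suc _ = trans (≤?-true k<suc) (sym (cong₂ _xor_
      (dec-true (k ≤? inject₁ i) (subst (toℕ k ℕ.≤_) (sym (toℕ-inject₁ i)) (ℕ.s≤s⁻¹ k<suc)))
      (dec-false (k ≟ suc i) k≢suc)))
    ... | tri≈ _ refl _ = trans (≤?-refl k) (sym (cong₂ _xor_
      (≤?-false i<suc) (dec-true (k ≟ suc i) refl)))
    ... | tri> _ k≢suc suc<k = trans (≤?-false suc<k) (sym (cong₂ _xor_
      (≤?-false (<-trans {j = suc i} i<suc suc<k)) (dec-false (k ≟ suc i) k≢suc)))

  prefixSum-zero : ∀ x γ → prefixSum x γ zero ≡ x (at γ zero)
  prefixSum-zero x γ = trans (sum-cong-≗ λ k → cong (_∧ x (at γ k)) (≤?-zero k))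
                             (sum-δ zero (x ∘ at γ))
    where
    ≤?-zero : ∀ {n} (k : Fin (ℕ.suc n)) → does (k ≤? zero {n}) ≡ does (k ≟ zero)
    ≤?-zero zero    = refl
    ≤?-zero (suc k) = refl

  -- A circuit of an Euler system passes every vertex twice or not at all.
  sum-at : ∀ x γ → sum (x ∘ at γ) ≡ false
  sum-at x γ = trans (sum-fibres (at γ) (λ _ → true) x) (sum-0 even)
    where
    visitCount : ∀ {w δ p q} → Visits w δ p q → Dec (γ ≡ δ) →
                 sum (λ k → does (at γ k ≟ w) ∧ true) ≡ false
    visitCount w-visits (yes refl) = sum-visits w-visits (λ _ → true)
    visitCount w-visits (no γ≢δ)   = sum-no-visits w-visits γ≢δ (λ _ → true)

    even : ∀ w → sum (λ k → does (at γ k ≟ w) ∧ true) ∧ x w ≡ false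
    even w = let δ , _ , _ , w-visits = visits w in cong (_∧ x w) (visitCount w-visits (γ ≟ δ))

  prefixSum-fromℕ : ∀ x γ → prefixSum x γ (fromℕ (length-1 γ)) ≡ false
  prefixSum-fromℕ x γ = trans
    (sum-cong-≗ λ k → cong (_∧ x (at γ k)) (dec-true (k ≤? fromℕ _)
      (subst (toℕ k ℕ.≤_) (sym (toℕ-fromℕ _)) (toℕ≤pred[n] k))))
    (sum-at x γ)

  prefixSum-cyclicSuc : ∀ x γ i →
    prefixSum x γ (cyclicSuc i) ≡ prefixSum x γ i xor x (at γ (cyclicSuc i))
  prefixSum-cyclicSuc x γ i with view i
  ... | ‵inject₁ j rewrite cyclicSuc-inject₁ j = prefixSum-suc x γ j
  ... | ‵fromℕ rewrite cyclicSuc-fromℕ (length-1 γ) | prefixSum-fromℕ x γ = prefixSum-zero x γ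

  -- The labelling by prefix sums; it vanishes at the last position of each
  -- circuit, which makes it agree with its jump at position zero.
  potential : Vector GF2 #V → HalfEdge → GF2
  potential x h = prefixSum x (circuitOf h) (position h)

  potential-out : ∀ x γ i → potential x (out γ i) ≡ prefixSum x γ i
  potential-out x γ i = samePosition (edge-position (out γ i))
    where
    samePosition : ∀ {δ j} → edge (out δ j) ≡ edge (out γ i) → prefixSum x δ j ≡ prefixSum x γ i
    samePosition {δ} {j} eq
      with refl ← trans (sym (circuitOf-unique (out γ i) (j , eq))) (circuitOf-out γ i)
      with refl ← Circuit.trail (circuit γ) eq = refl

  potential-jumps : ∀ x → JumpsBy x (potential x)
  potential-jumps x = record { onEdges = λ _ → refl ; jump = jump }
    where
    z = potential x

    step : ∀ γ i → z (out γ (cyclicSuc i)) ≡ z (out γ i) xor x (at γ (cyclicSuc i))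
    step γ i = begin
      z (out γ (cyclicSuc i))                         ≡⟨ potential-out x γ (cyclicSuc i) ⟩
      prefixSum x γ (cyclicSuc i)                     ≡⟨ prefixSum-cyclicSuc x γ i ⟩
      prefixSum x γ i xor x (at γ (cyclicSuc i))      ≡⟨ cong (_xor x (at γ (cyclicSuc i))) (potential-out x γ i) ⟨
      z (out γ i) xor x (at γ (cyclicSuc i))          ∎

    jump : ∀ h → z (partner h) ≡ z h xor x (vertex h)
    jump h with occurrence h
    ... | arriving γ i = begin
      z (partner (opposite (out γ i)))                ≡⟨ cong z (follows γ i) ⟩
      z (out γ (cyclicSuc i))                         ≡⟨ step γ i ⟩
      z (out γ i) xor x (at γ (cyclicSuc i))          ≡⟨ cong (λ v → z (out γ i) xor x v) (Circuit.closed (circuit γ) i) ⟨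
      z (out γ i) xor x (vertex (opposite (out γ i))) ∎
    ... | leaving γ i with j , refl ← cyclicSuc-surjective i = begin
      z (partner (out γ (cyclicSuc j)))               ≡⟨ cong z (partner-leaving γ j) ⟩
      z (out γ j)                                     ≡⟨ xor-cancelʳ (z (out γ j)) t ⟨
      (z (out γ j) xor t) xor t                       ≡⟨ cong (_xor t) (step γ j) ⟨
      z (out γ (cyclicSuc j)) xor t                   ∎
      where t = x (at γ (cyclicSuc j))

  module _ {x : Vector GF2 #V} {z : HalfEdge → GF2} (z-jumps : JumpsBy x z) where
    open JumpsBy z-jumps

    jump-step : ∀ γ i → z (out γ (cyclicSuc i)) ≡ z (out γ i) xor x (at γ (cyclicSuc i))
    jump-step γ i = begin
      z (out γ (cyclicSuc i))                                    ≡⟨ cong z (follows γ i) ⟨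
      z (partner (opposite (out γ i)))                           ≡⟨ jump (opposite (out γ i)) ⟩
      z (opposite (out γ i)) xor x (vertex (opposite (out γ i))) ≡⟨ cong₂ (λ b v → b xor x v) (onEdges (out γ i)) (Circuit.closed (circuit γ) i) ⟩
      z (out γ i) xor x (at γ (cyclicSuc i))                     ∎

    -- On each circuit of C, z differs from the prefix sums by a constant.
    out-prefixSum : ∀ γ a b → z (out γ a) xor prefixSum x γ a ≡ z (out γ b) xor prefixSum x γ b
    out-prefixSum γ a b = trans (constant a) (sym (constant b))
      where
      constant : ∀ i → z (out γ i) xor prefixSum x γ i ≡ z (out γ zero) xor prefixSum x γ zero
      constant = cyclicSuc-constant (λ i → z (out γ i) xor prefixSum x γ i) λ i →
        trans (cong₂ _xor_ (jump-step γ i) (prefixSum-cyclicSuc x γ i))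
              (xor-cancel-common (z (out γ i)) (prefixSum x γ i) _)

    visits-sum : ∀ {v γ a b} → Visits v γ a b →
                 z (out γ a) xor z (out γ b) ≡ x v xor (interlacement F C *ᵛ x) v
    visits-sum {v} {γ} {a} {b} v-visits = begin
      z (out γ a) xor z (out γ b)
        ≡⟨ xor-transpose {z (out γ a)} {z (out γ b)} {prefixSum x γ a} {prefixSum x γ b} (out-prefixSum γ a b) ⟩
      prefixSum x γ b xor prefixSum x γ a
        ≡⟨ sum-xor-∧ {d = λ k → does (k ≤? b)} {λ k → does (k ≤? a)} (x ∘ at γ) (λ _ → refl) ⟨
      sum (λ k → segment a b k ∧ x (at γ k))
        ≡⟨ sum-fibres (at γ) (segment a b) x ⟩
      sum (λ w → sum (λ k → does (at γ k ≟ w) ∧ segment a b k) ∧ x w)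
        ≡⟨ sum-xor-∧ {d = λ w → does (w ≟ v)} {interlacement F C v} x (segment-count v-visits) ⟩
      sum (λ w → does (w ≟ v) ∧ x w) xor (interlacement F C *ᵛ x) v
        ≡⟨ cong (_xor (interlacement F C *ᵛ x) v) (sum-δ v x) ⟩
      x v xor (interlacement F C *ᵛ x) v ∎

    departures : ∀ {v γ a b h h′} → Visits v γ a b → vertex h ≡ v → vertex h′ ≡ v → h ≢ h′ →
                 outward h ≡ true → outward h′ ≡ true →
                 z h xor z h′ ≡ z (out γ a) xor z (out γ b)
    departures {γ = γ} {a} {b} {h} {h′} v-visits h-v h′-v h≢h′ h-out h′-out
      with δ , i , refl ← outward⇒leaving h h-out
      with η , j , refl ← outward⇒leaving h′ h′-out
      with Visits.only v-visits δ i h-v | Visits.only v-visits η j h′-v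
    ... | inj₁ h≡a | inj₂ h′≡b = cong₂ (λ g g′ → z g xor z g′) h≡a h′≡b
    ... | inj₂ h≡b | inj₁ h′≡a = trans (cong₂ (λ g g′ → z g xor z g′) h≡b h′≡a)
                                       (xor-comm (z (out γ b)) _)
    ... | inj₁ h≡a | inj₁ h′≡a = contradiction (trans h≡a (sym h′≡a)) h≢h′
    ... | inj₂ h≡b | inj₂ h′≡b = contradiction (trans h≡b (sym h′≡b)) h≢h′

    departures-sum : ∀ {v h h′} → vertex h ≡ v → vertex h′ ≡ v → h ≢ h′ →
                     outward h ≡ true → outward h′ ≡ true →
                     z h xor z h′ ≡ x v xor (interlacement F C *ᵛ x) v
    departures-sum {v} h-v h′-v h≢h′ h-out h′-out =
      let _ , _ , _ , v-visits = visits v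
      in trans (departures v-visits h-v h′-v h≢h′ h-out h′-out) (visits-sum v-visits)

    -- The same for the two arrivals as for the two departures at a vertex.
    sameDirection-sum : ∀ {h h′} → vertex h′ ≡ vertex h → h ≢ h′ → outward h ≡ outward h′ →
                        z h xor z h′ ≡ x (vertex h) xor (interlacement F C *ᵛ x) (vertex h)
    sameDirection-sum {h} {h′} h′-v h≢h′ same = case-direction (outward h) refl
      where
      v = vertex h

      case-direction : ∀ d → outward h ≡ d → z h xor z h′ ≡ x v xor (interlacement F C *ᵛ x) v
      case-direction true  h-out = departures-sum refl h′-v h≢h′ h-out (trans (sym same) h-out)
      -- Both labels of arriving half-edges change by x v on departure.
      case-direction false h-in = begin
        z h xor z h′
          ≡⟨ xor-cancel-common (z h) (z h′) (x v) ⟨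
        (z h xor x v) xor (z h′ xor x v)
          ≡⟨ cong₂ _xor_ (jump h) (trans (jump h′) (cong (λ w → z h′ xor x w) h′-v)) ⟨
        z (partner h) xor z (partner h′)
          ≡⟨ departures-sum (partner-vertex h) (trans (partner-vertex h′) h′-v)
               (h≢h′ ∘ partner-injective transitions)
               (trans (outward-partner h) (cong not h-in))
               (trans (outward-partner h′) (cong not (trans (sym same) h-in))) ⟩
        x v xor (interlacement F C *ᵛ x) v ∎

------------------------------------------------------------------------
-- Transition labels

module Relative (F : Multigraph) (4-regular : FourRegular F)
                (P C : CircuitPartition F) (euler : IsEulerSystem F C) where
  open Multigraph F
  open FourHalfEdges F 4-regular
  open EulerSystem F 4-regular C euler
  private
    module P = Partition P
    module C = Partition C
  open C using (outward; outward-opposite; outward-partner)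

  outDirected : ∀ {h} → outward h ≡ true → OutDirected F C h
  outDirected = dec-true⁻¹ (outDirected? F C _)

  inDirected : ∀ {h} → outward h ≡ false → InDirected F C h
  inDirected {h} eq = outDirected (trans (outward-opposite h) (cong not eq))

  outDirected⇒outward : ∀ {h} → OutDirected F C h → outward h ≡ true
  outDirected⇒outward = dec-true (outDirected? F C _)

  inDirected⇒outward : ∀ {h} → InDirected F C h → outward h ≡ false
  inDirected⇒outward {h} h-in = begin
    outward h                    ≡⟨ not-involutive (outward h) ⟨
    not (not (outward h))        ≡⟨ cong not (outward-opposite h) ⟨
    not (outward (opposite h))   ≡⟨ cong not (outDirected⇒outward h-in) ⟩
    false                        ∎

  -- Whether P pairs h with a half-edge of the opposite direction (r is true) or
  -- of the same direction (r is false).  Where P does not follow C, the former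
  -- characterizes the label χ and the latter the label ψ.
  Turns : Bool → HalfEdge → Set
  Turns r h = outward (P.partner h) ≡ r xor outward h

  χ⇒turns : ∀ {v} → Involves-χ F P C v → ∀ h → vertex h ≡ v → Turns true h
  χ⇒turns (_ , all) h h-v with at-halfEdgesAt F all h h-v
  ... | inj₁ (h-in , p-out) = trans (outDirected⇒outward p-out) (cong not (sym (inDirected⇒outward h-in)))
  ... | inj₂ (h-out , p-in) = trans (inDirected⇒outward p-in) (cong not (sym (outDirected⇒outward h-out)))

  ψ⇒turns : ∀ {v} → Involves-ψ F P C v → ∀ h → vertex h ≡ v → Turns false h
  ψ⇒turns all h h-v with at-halfEdgesAt F all h h-v
  ... | inj₁ (h-in , p-in)   = trans (inDirected⇒outward p-in) (sym (inDirected⇒outward h-in))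
  ... | inj₂ (h-out , p-out) = trans (outDirected⇒outward p-out) (sym (outDirected⇒outward h-out))

  turns⇒χ : ∀ {v} → ¬ Involves-φ F P C v → (∀ h → vertex h ≡ v → Turns true h) → Involves-χ F P C v
  turns⇒χ ¬φ turns = ¬φ , all-halfEdgesAt F λ h h-v → directions (outward h) refl (turns h h-v)
    where
    directions : ∀ d {h} → outward h ≡ d → Turns true h →
                 (InDirected F C h × OutDirected F C (P.partner h)) ⊎
                 (OutDirected F C h × InDirected F C (P.partner h))
    directions true  eq turn = inj₂ (outDirected eq , inDirected (trans turn (cong not eq)))
    directions false eq turn = inj₁ (inDirected eq , outDirected (trans turn (cong not eq)))

  turns⇒ψ : ∀ {v} → (∀ h → vertex h ≡ v → Turns false h) → Involves-ψ F P C v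
  turns⇒ψ turns = all-halfEdgesAt F λ h h-v → directions (outward h) refl (turns h h-v)
    where
    directions : ∀ d {h} → outward h ≡ d → Turns false h →
                 (InDirected F C h × InDirected F C (P.partner h)) ⊎
                 (OutDirected F C h × OutDirected F C (P.partner h))
    directions true  eq turn = inj₂ (outDirected eq , outDirected (trans turn eq))
    directions false eq turn = inj₁ (inDirected eq , inDirected (trans turn eq))

  -- Where the transitions of P and C differ, the four half-edges are one
  -- orbit under the two pairings.
  orbit : ∀ {g} (R : HalfEdge → Set) → P.partner g ≢ C.partner g →
          R g → R (C.partner g) → (∀ h → R h → R (P.partner h)) →
          ∀ h → vertex h ≡ vertex g → R h
  orbit {g} R pg≢cg Rg Rcg step h h-v
    with ∈-resp-↭ (proj₁ (commuting P.transitions C.transitions pg≢cg))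
                  (subst (λ v → h ∈ˡ halfEdgesAt v) h-v (∈-halfEdgesAt F h))
  ... | here refl                         = Rg
  ... | there (here refl)                 = Rcg
  ... | there (there (here refl))         = step _ Rg
  ... | there (there (there (here refl))) = step _ Rcg

  disagree-orbit : ∀ {g} → P.partner g ≢ C.partner g →
                   ∀ h → vertex h ≡ vertex g → P.partner h ≢ C.partner h
  disagree-orbit {g} pg≢cg = orbit (λ h → P.partner h ≢ C.partner h) pg≢cg pg≢cg
    (λ eq → pg≢cg (trans (cong P.partner (sym (trans eq (C.partner-involutive g))))
                         (P.partner-involutive _)))
    (λ h ph≢ch eq → ph≢ch (trans (sym (C.partner-involutive _))
                         (cong C.partner (trans (sym eq) (P.partner-involutive h)))))

  agree⇒φ : ∀ h → P.partner h ≡ C.partner h → Involves-φ F P C (vertex h)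
  agree⇒φ h ph≡ch = all-halfEdgesAt F λ g g-v →
    decidable-stable (P.partner g ≟ʰ C.partner g) λ pg≢cg → disagree-orbit pg≢cg h (sym g-v) ph≡ch

  turns-orbit : ∀ {g} r → P.partner g ≢ C.partner g → Turns r g →
                ∀ h → vertex h ≡ vertex g → Turns r h
  turns-orbit {g} r pg≢cg turn = orbit (Turns r) pg≢cg turn
    (begin
      outward (P.partner (C.partner g))   ≡⟨ cong outward (proj₂ (commuting P.transitions C.transitions pg≢cg)) ⟩
      outward (C.partner (P.partner g))   ≡⟨ outward-partner (P.partner g) ⟩
      not (outward (P.partner g))         ≡⟨ cong not turn ⟩
      not (r xor outward g)               ≡⟨ not-distribʳ-xor r (outward g) ⟩
      r xor not (outward g)               ≡⟨ cong (r xor_) (outward-partner g) ⟨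
      r xor outward (C.partner g)         ∎)
    (λ h turn-h → begin
      outward (P.partner (P.partner h))   ≡⟨ cong outward (P.partner-involutive h) ⟩
      outward h                           ≡⟨ xor-cancelˡ r (outward h) ⟨
      r xor (r xor outward h)             ≡⟨ cong (r xor_) turn-h ⟨
      r xor outward (P.partner h)         ∎)

  -- The label of the transition of P at v, with the exclusions on which the
  -- entries of the relative matrix and of the core vectors depend.
  data Label (v : Vertex) : Set where
    φ : Involves-φ F P C v → ¬ Involves-ψ F P C v → Label v
    χ : ¬ Involves-φ F P C v → Involves-χ F P C v → ¬ Involves-ψ F P C v → Label v
    ψ : ¬ Involves-φ F P C v → Involves-ψ F P C v → Label v

  label : ∀ v → Label v
  label v = let h , h-v = halfEdgeAt v in byTransition h h-v (involves-φ? F P C v)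
    where
    byTransition : ∀ h → vertex h ≡ v → Dec (Involves-φ F P C v) → Label v
    byTransition h h-v (yes v-φ) = φ v-φ λ v-ψ → not-¬ (ψ⇒turns v-ψ h h-v) (begin
      outward (P.partner h)   ≡⟨ cong outward (at-halfEdgesAt F v-φ h h-v) ⟩
      outward (C.partner h)   ≡⟨ outward-partner h ⟩
      not (outward h)         ∎)
    byTransition h refl (no ¬φ) = byTurn (outward (P.partner h) Bool.≟ outward h)
      where
      disagree : P.partner h ≢ C.partner h
      disagree = ¬φ ∘ agree⇒φ h

      byTurn : Dec (outward (P.partner h) ≡ outward h) → Label (vertex h)
      byTurn (yes same) = ψ ¬φ (turns⇒ψ (turns-orbit false disagree same))
      byTurn (no ¬same) = χ ¬φ (turns⇒χ ¬φ (turns-orbit true disagree (¬-not ¬same)))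
                            λ v-ψ → ¬same (ψ⇒turns v-ψ h refl)

------------------------------------------------------------------------
-- The relative interlacement matrix

  diagonal-entry : ∀ v → relativeInterlacement F P C v v ≡
                         does (involves-φ? F P C v) ∨ does (involves-ψ? F P C v)
  diagonal-entry v = cong (if_then does (involves-φ? F P C v) ∨ does (involves-ψ? F P C v) else
    (if does (involves-φ? F P C v) ∨ does (involves-φ? F P C v) then 0# else interlacement F C v v))
    (dec-true (v ≟ v) refl)

  offDiagonal-entry : ∀ {v w} → v ≢ w → relativeInterlacement F P C v w ≡
    (if does (involves-φ? F P C v) ∨ does (involves-φ? F P C w) then 0# else interlacement F C v w)
  offDiagonal-entry {v} {w} v≢w =
    cong (if_then does (involves-φ? F P C v) ∨ does (involves-ψ? F P C v) else
    (if does (involves-φ? F P C v) ∨ does (involves-φ? F P C w) then 0# else interlacement F C v w))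
    (dec-false (v ≟ w) v≢w)

  φ-row : ∀ {v} → Involves-φ F P C v → ∀ x → (relativeInterlacement F P C *ᵛ x) v ≡ x v
  φ-row {v} v-φ x = trans (sum-cong-≗ λ w → cong (_∧ x w) (entry w (w ≟ v))) (sum-δ v x)
    where
    entry : ∀ w (w≟v : Dec (w ≡ v)) → relativeInterlacement F P C v w ≡ does w≟v
    entry w (yes refl) = trans (diagonal-entry v)
      (cong (_∨ does (involves-ψ? F P C v)) (dec-true (involves-φ? F P C v) v-φ))
    entry w (no w≢v) = trans (offDiagonal-entry (w≢v ∘ sym))
      (cong (λ b → if b ∨ does (involves-φ? F P C w) then 0# else interlacement F C v w)
        (dec-true (involves-φ? F P C v) v-φ))

  VanishesAtφ : Vector GF2 #V → Set
  VanishesAtφ x = ∀ v → Involves-φ F P C v → x v ≡ false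

  -- The columns of φ vertices that the relative matrix sets to zero do not
  -- contribute when x vanishes there.
  nonφ-row : ∀ {v} → ¬ Involves-φ F P C v → ∀ {x} → VanishesAtφ x →
             (relativeInterlacement F P C *ᵛ x) v ≡
             (does (involves-ψ? F P C v) ∧ x v) xor (interlacement F C *ᵛ x) v
  nonφ-row {v} ¬φ {x} vanish = begin
    (relativeInterlacement F P C *ᵛ x) v
      ≡⟨ sum-cong-≗ (λ w → entry w (w ≟ v) (involves-φ? F P C w)) ⟩
    sum (λ w → (does (w ≟ v) ∧ (isψ ∧ x w)) xor (interlacement F C v w ∧ x w))
      ≡⟨ ∑-distrib-+ (λ w → does (w ≟ v) ∧ (isψ ∧ x w)) (λ w → interlacement F C v w ∧ x w) ⟩
    sum (λ w → does (w ≟ v) ∧ (isψ ∧ x w)) xor (interlacement F C *ᵛ x) v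
      ≡⟨ cong (_xor (interlacement F C *ᵛ x) v) (sum-δ v (λ w → isψ ∧ x w)) ⟩
    (isψ ∧ x v) xor (interlacement F C *ᵛ x) v ∎
    where
    isψ = does (involves-ψ? F P C v)

    v-not-φ : does (involves-φ? F P C v) ≡ false
    v-not-φ = dec-false (involves-φ? F P C v) ¬φ

    entry : ∀ w (w≟v : Dec (w ≡ v)) → Dec (Involves-φ F P C w) →
            relativeInterlacement F P C v w ∧ x w ≡
            (does w≟v ∧ (isψ ∧ x w)) xor (interlacement F C v w ∧ x w)
    entry w (yes refl) _ = trans
      (cong (_∧ x v) (trans (diagonal-entry v) (cong (_∨ isψ) v-not-φ)))
      (sym (trans (cong (λ b → (isψ ∧ x v) xor (b ∧ x v))
                    (dec-false (interlaced? F C v v) λ (v≢v , _) → v≢v refl))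
                  (xor-identityʳ _)))
    entry w (no w≢v) (yes w-φ) = trans (zero-at-w _) (sym (zero-at-w _))
      where
      zero-at-w : ∀ b → b ∧ x w ≡ false
      zero-at-w b = trans (cong (b ∧_) (vanish w w-φ)) (∧-zeroʳ b)
    entry w (no w≢v) (no ¬w-φ) = cong (_∧ x w) (trans (offDiagonal-entry (w≢v ∘ sym))
      (cong₂ (λ b c → if b ∨ c then 0# else interlacement F C v w)
        v-not-φ (dec-false (involves-φ? F P C w) ¬w-φ)))

  -- The relative interlacement matrix measures how far a labelling with
  -- jump vector x is from being constant on the circuits of P.
  relativeInterlacement-jumps :
    ∀ {x z} → JumpsBy x z → VanishesAtφ x →
    ∀ h → z h xor z (P.partner h) ≡ (relativeInterlacement F P C *ᵛ x) (vertex h)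
  relativeInterlacement-jumps {x} {z} z-jumps vanish h = byLabel (label v)
    where
    open JumpsBy z-jumps
    v = vertex h
    Ix = (interlacement F C *ᵛ x) v

    byLabel : Label v → z h xor z (P.partner h) ≡ (relativeInterlacement F P C *ᵛ x) v
    byLabel (φ v-φ _) = begin
      z h xor z (P.partner h)   ≡⟨ cong (λ g → z h xor z g) (at-halfEdgesAt F v-φ h refl) ⟩
      z h xor z (C.partner h)   ≡⟨ cong (z h xor_) (jump h) ⟩
      z h xor (z h xor x v)     ≡⟨ xor-cancelˡ (z h) (x v) ⟩
      x v                       ≡⟨ φ-row v-φ x ⟨
      (relativeInterlacement F P C *ᵛ x) v ∎
    byLabel (ψ ¬φ v-ψ) = begin
      z h xor z (P.partner h)
        ≡⟨ sameDirection-sum z-jumps (P.partner-vertex h) (P.partner-distinct h ∘ sym)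
             (sym (ψ⇒turns v-ψ h refl)) ⟩
      x v xor Ix
        ≡⟨ cong (λ b → (b ∧ x v) xor Ix) (dec-true (involves-ψ? F P C v) v-ψ) ⟨
      (does (involves-ψ? F P C v) ∧ x v) xor Ix
        ≡⟨ nonφ-row ¬φ vanish ⟨
      (relativeInterlacement F P C *ᵛ x) v ∎
    -- C leads from P.partner h on to the other half-edge h′ with the direction
    -- of h, and the label changes by x v on the way.
    byLabel (χ ¬φ v-χ ¬ψ) = begin
      z h xor z (P.partner h)
        ≡⟨ cong (z h xor_) (xor-cancelʳ (z (P.partner h)) (x v)) ⟨
      z h xor ((z (P.partner h) xor x v) xor x v)
        ≡⟨ cong (λ b → z h xor (b xor x v))
             (trans (jump (P.partner h)) (cong (λ w → z (P.partner h) xor x w) (P.partner-vertex h))) ⟨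
      z h xor (z h′ xor x v)
        ≡⟨ xor-assoc (z h) (z h′) (x v) ⟨
      (z h xor z h′) xor x v
        ≡⟨ cong (_xor x v) (sameDirection-sum z-jumps
             (trans (C.partner-vertex (P.partner h)) (P.partner-vertex h)) h≢h′ same) ⟩
      (x v xor Ix) xor x v
        ≡⟨ cong (_xor x v) (xor-comm (x v) Ix) ⟩
      (Ix xor x v) xor x v
        ≡⟨ xor-cancelʳ Ix (x v) ⟩
      Ix
        ≡⟨ cong (λ b → (b ∧ x v) xor Ix) (dec-false (involves-ψ? F P C v) ¬ψ) ⟨
      (does (involves-ψ? F P C v) ∧ x v) xor Ix
        ≡⟨ nonφ-row ¬φ vanish ⟨
      (relativeInterlacement F P C *ᵛ x) v ∎
      where
      h′ = C.partner (P.partner h)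

      h≢h′ : h ≢ h′
      h≢h′ eq = ¬φ (agree⇒φ h (trans (sym (C.partner-involutive _)) (cong C.partner (sym eq))))

      same : outward h ≡ outward h′
      same = begin
        outward h                     ≡⟨ not-involutive (outward h) ⟨
        not (not (outward h))         ≡⟨ cong not (χ⇒turns v-χ h refl) ⟨
        not (outward (P.partner h))   ≡⟨ outward-partner (P.partner h) ⟨
        outward h′                    ∎

------------------------------------------------------------------------
-- Relative core vectors

  -- The characteristic function of γ jumps by the relative core vector.
  onCircuit-jump : ∀ γ h → P.onCircuit γ h xor P.onCircuit γ (C.partner h) ≡
                           relativeCore F P C γ (vertex h)
  onCircuit-jump γ h = byLabel (label v)
    where
    v = vertex h
    s = P.onCircuit γ
    isχ = does (involves-χ? F P C v)
    isψ = does (involves-ψ? F P C v)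
    contains? : (g : HalfEdge) → Dec (Circuit.ContainsEdge (P.circuit γ) (edge g))
    contains? g = Circuit.containsEdge? (P.circuit γ) (edge g)
    isSingle = does (Circuit.singlyIncident? (P.circuit γ) v)

    -- As γ contains both or neither of two half-edges paired by P, it contains two
    -- of the four half-edges exactly when it separates h from C.partner h.
    single : ¬ Involves-φ F P C v → isSingle ≡ s h xor s (C.partner h)
    single ¬φ =
      let perm , commute = commuting P.transitions C.transitions (¬φ ∘ agree⇒φ h)
      in trans (cong (λ n → does (n ℕ.≟ 2)) (↭-length (filter-↭ contains? perm)))
               (filter-pairs contains? h (C.partner h) (P.partner h) (P.partner (C.partner h))
                 (P.onCircuit-partner γ h) (P.onCircuit-partner γ (C.partner h)))

    byLabel : Label v → s h xor s (C.partner h) ≡ (isχ ∨ isψ) ∧ isSingle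
    byLabel (φ v-φ ¬ψ) = trans
      (trans (cong (s h xor_) (trans (cong s (sym (at-halfEdgesAt F v-φ h refl)))
        (P.onCircuit-partner γ h))) (xor-same (s h)))
      (sym (cong₂ (λ b c → (b ∨ c) ∧ isSingle)
        (dec-false (involves-χ? F P C v) λ (¬φ , _) → ¬φ v-φ) (dec-false (involves-ψ? F P C v) ¬ψ)))
    byLabel (χ ¬φ v-χ _) = sym (trans
      (cong (λ b → (b ∨ isψ) ∧ isSingle) (dec-true (involves-χ? F P C v) v-χ)) (single ¬φ))
    byLabel (ψ ¬φ v-ψ) = sym (trans
      (cong (λ b → (isχ ∨ b) ∧ isSingle) (dec-true (involves-ψ? F P C v) v-ψ))
      (trans (cong (_∧ isSingle) (∨-zeroʳ isχ)) (single ¬φ)))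

  -- A labelling with the constant value c γ on each circuit γ of P jumps by the
  -- corresponding combination of relative core vectors.
  combination-core : ∀ (c : Vector GF2 P.size) h →
    combination c (relativeCore F P C) (vertex h) ≡
    c (P.circuitOf h) xor c (P.circuitOf (C.partner h))
  combination-core c h = begin
    sum (λ γ → c γ ∧ relativeCore F P C γ (vertex h))
      ≡⟨ sum-cong-≗ (λ γ → trans (cong (c γ ∧_) (sym (onCircuit-jump γ h)))
           (∧-distribˡ-xor (c γ) (P.onCircuit γ h) (P.onCircuit γ (C.partner h)))) ⟩
    sum (λ γ → (c γ ∧ P.onCircuit γ h) xor (c γ ∧ P.onCircuit γ (C.partner h)))
      ≡⟨ ∑-distrib-+ (λ γ → c γ ∧ P.onCircuit γ h) (λ γ → c γ ∧ P.onCircuit γ (C.partner h)) ⟩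
    sum (λ γ → c γ ∧ P.onCircuit γ h) xor sum (λ γ → c γ ∧ P.onCircuit γ (C.partner h))
      ≡⟨ cong₂ _xor_ (P.sum-onCircuit c h) (P.sum-onCircuit c (C.partner h)) ⟩
    c (P.circuitOf h) xor c (P.circuitOf (C.partner h)) ∎

  nullspace⇒span : ∀ x → Nullspace (relativeInterlacement F P C) x → Span (relativeCore F P C) x
  nullspace⇒span x Mx≡0 = c , x≡
    where
    z = potential x
    open JumpsBy (potential-jumps x)

    z-constant : ∀ h → z (P.partner h) ≡ z h
    z-constant h = sym (xor-false⇒≡ (trans
      (relativeInterlacement-jumps (potential-jumps x)
        (λ v v-φ → trans (sym (φ-row v-φ x)) (Mx≡0 v)) h)
      (Mx≡0 (vertex h))))

    c : Vector GF2 P.size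
    c γ = z (P.out γ zero)

    z≡c : ∀ h → z h ≡ c (P.circuitOf h)
    z≡c = P.constantOnCircuits z onEdges z-constant

    x≡ : x ≗ combination c (relativeCore F P C)
    x≡ = atEveryVertex (λ v → x v ≡ combination c (relativeCore F P C) v) λ h → begin
      x (vertex h)                     ≡⟨ xor-cancelˡ (z h) (x (vertex h)) ⟨
      z h xor (z h xor x (vertex h))   ≡⟨ cong (z h xor_) (jump h) ⟨
      z h xor z (C.partner h)     ≡⟨ cong₂ _xor_ (z≡c h) (z≡c (C.partner h)) ⟩
      c (P.circuitOf h) xor c (P.circuitOf (C.partner h)) ≡⟨ combination-core c h ⟨
      combination c (relativeCore F P C) (vertex h) ∎

  span⇒nullspace : ∀ x → Span (relativeCore F P C) x → Nullspace (relativeInterlacement F P C) x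
  span⇒nullspace x (c , x≡) =
    atEveryVertex (λ v → (relativeInterlacement F P C *ᵛ x) v ≡ false) λ h → begin
      (relativeInterlacement F P C *ᵛ x) (vertex h)  ≡⟨ relativeInterlacement-jumps z-jumps vanish h ⟨
      z h xor z (P.partner h)                        ≡⟨ z-constant h ⟩
      false                                          ∎
    where
    z : HalfEdge → GF2
    z h = c (P.circuitOf h)

    x-jump : ∀ h → x (vertex h) ≡ z h xor z (C.partner h)
    x-jump h = trans (x≡ (vertex h)) (combination-core c h)

    z-jumps : JumpsBy x z
    z-jumps = record
      { onEdges = λ _ → refl
      ; jump    = λ h → sym (trans (cong (z h xor_) (x-jump h)) (xor-cancelˡ (z h) _))
      }

    z-constant : ∀ h → z h xor z (P.partner h) ≡ false
    z-constant h = trans (cong (λ γ → z h xor c γ) (P.circuitOf-partner h)) (xor-same (z h))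

    vanish : VanishesAtφ x
    vanish = atEveryVertex (λ v → Involves-φ F P C v → x v ≡ false) λ h v-φ → begin
      x (vertex h)               ≡⟨ x-jump h ⟩
      z h xor z (C.partner h)    ≡⟨ cong (λ g → z h xor z g) (at-halfEdgesAt F v-φ h refl) ⟨
      z h xor z (P.partner h)    ≡⟨ z-constant h ⟩
      false                      ∎

  component-sum : ∀ K → IsComponent K →
                  combination (P.incidenceVector K) (relativeCore F P C) ≗ 0ᵛ
  component-sum K K-component =
    atEveryVertex (λ v → combination (P.incidenceVector K) (relativeCore F P C) v ≡ false) λ h → begin
      combination (P.incidenceVector K) (relativeCore F P C) (vertex h)
        ≡⟨ combination-core (P.incidenceVector K) h ⟩
      P.incidenceVector K (P.circuitOf h) xor P.incidenceVector K (P.circuitOf (C.partner h))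
        ≡⟨ cong₂ _xor_ (incidence h) (incidence (C.partner h)) ⟩
      does (vertex h ∈? K) xor does (vertex (C.partner h) ∈? K)
        ≡⟨ cong (λ w → does (vertex h ∈? K) xor does (w ∈? K)) (C.partner-vertex h) ⟩
      does (vertex h ∈? K) xor does (vertex h ∈? K)
        ≡⟨ xor-same (does (vertex h ∈? K)) ⟩
      false ∎
    where
    incidence : ∀ h → P.incidenceVector K (P.circuitOf h) ≡ does (vertex h ∈? K)
    incidence h = does-⇔ (P.incident⇔vertex∈ K-component h)
      (P.incident? K (P.circuitOf h)) (vertex h ∈? K)

  independent : (Q : Subset P.size) →
    ¬ (∃[ K ] IsComponent K × (∀ γ → P.Incident K γ → γ ∈ Q)) →
    LinearlyIndependentOn Q (relativeCore F P C)
  independent Q noComponent c c-supp combination≡0 γ _ =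
    decidable-stable (c γ Bool.≟ false) λ cγ≢0 →
      component F (vertex (P.out γ zero)) λ (K , K⇔) →
        noComponent (K , (_ , K⇔) , λ δ δ-incident →
          decidable-stable (δ ∈? Q) λ δ∉Q → cγ≢0 (begin
            c γ                          ≡⟨ cong c (P.circuitOf-out γ zero) ⟨
            z (P.out γ zero)             ≡⟨ z-component (_ , K⇔) (Equivalence.from (K⇔ _) ε) (proj₂ δ-incident) ⟩
            z (P.out δ (proj₁ δ-incident)) ≡⟨ cong c (P.circuitOf-out δ _) ⟩
            c δ                          ≡⟨ c-supp δ δ∉Q ⟩
            false                        ∎))
    where
    z : HalfEdge → GF2
    z h = c (P.circuitOf h)

    z-constant : ∀ h → z (C.partner h) ≡ z h
    z-constant h = sym (xor-false⇒≡ (trans (sym (combination-core c h)) (combination≡0 (vertex h))))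

    z-circuit : ∀ h → z h ≡ z (C.out (C.circuitOf h) zero)
    z-circuit = C.constantOnCircuits z (λ _ → refl) z-constant

    z-component : ∀ {K h h′} → IsComponent K → vertex h ∈ K → vertex h′ ∈ K → z h ≡ z h′
    z-component {h = h} {h′} K-component h∈K h′∈K = begin
      z h                                ≡⟨ z-circuit h ⟩
      z (C.out (C.circuitOf h) zero)     ≡⟨ cong (λ ε → z (C.out ε zero)) (component-circuitOf K-component h h′ h∈K h′∈K) ⟩
      z (C.out (C.circuitOf h′) zero)    ≡⟨ z-circuit h′ ⟨
      z h′                               ∎

theorem16 : (F : Multigraph) → FourRegular F →
    (P C : CircuitPartition F) → IsEulerSystem F C →
    (∀ x → Nullspace (relativeInterlacement F P C) x ⇔ Span (relativeCore F P C) x)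
    ×
    (∀ K → Multigraph.IsComponent F K →
    combination (CircuitPartition.incidenceVector P K) (relativeCore F P C) ≗ 0ᵛ)
    ×
    ((Q : Subset (CircuitPartition.size P)) →
    ¬ (∃[ K ] Multigraph.IsComponent F K ×
    (∀ γ → CircuitPartition.Incident P K γ → γ ∈ Q)) →
    LinearlyIndependentOn Q (relativeCore F P C))
theorem16 F 4-regular P C euler =
  (λ x → mk⇔ (nullspace⇒span x) (span⇒nullspace x)) , component-sum , independent
  where open Relative F 4-regular P C euler
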